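{- Let $n,m$ be positive integers, $\zeta_n=e^{2\pi\sqrt{ -1}/n}$, and for positive integers $s_1,\dots,s_m$ put $$\mathfrak Z_n(\zeta_n;;s_1,\dots,s_m)=\sum_{1\le i_1<\dots<i_m\le n-1}\prod_{k=1}^m\frac{1}{(1-\zeta_n^{i_k})^{s_k}}.$$ For a positive integer $A$ write $\mathfrak Z_n(\zeta_n;;2^{j-1},A,2^{m-j})$ for this sum with $s_j=A$ and $s_i=2$ for $i\ne j$. Then for even $A\ge 2$, \begin{align*} \sum_{j=1}^{m}\mathfrak Z_n(\zeta_n;;2^{j-1},A,2^{m-j}) &=\sum_{k=0}^{\frac{A}{2}-2}\sum_{j=1}^{A-2 k-2}\frac{(-1)^{k+1}n^j\beta_j(n^{ -1})}{n(m+k+1)\,j!}\binom{A-2 k-3}{j-1}\left(\binom{n-1}{m+k}+(-1)^{m+k}\binom{n-1}{2 m+2 k+1}\right)\\ &\quad +(-1)^{\frac{A}{2}-1}\frac{m+\frac{A}{2}-1}{n(m+\frac{A}{2})}\left(\binom{n-1}{m+\frac{A}{2}-1}+(-1)^{m+\frac{A}{2}-1}\binom{n-1}{2 m+A-1}\right), \end{align*} and for odd $A\ge 1$, \begin{align*} \sum_{j=1}^{m}\mathfrak Z_n(\zeta_n;;2^{j-1},A,2^{m-j}) &=\sum_{k=0}^{\frac{A-3}{2}}\sum_{j=1}^{A-2 k-2}\frac{(-1)^{k+1}n^j\beta_j(n^{ -1})}{n(m+k+1)\,j!}\binom{A-2 k-3}{j-1}\left(\binom{n-1}{m+k}+(-1)^{m+k}\binom{n-1}{2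 m+2 k+1}\right)\\ &\quad +(-1)^{\frac{A-1}{2}}\frac{1}{n}\left(\binom{n-1}{m+\frac{A-1}{2}}+(-1)^{m+\frac{A-3}{2}}\binom{n-1}{2 m+A-1}\right). \end{align*}
   Context: The degenerate Bernoulli numbers $\beta_k(\lambda)$ (Carlitz) are defined by $\dfrac{t}{(1+\lambda t)^{1/\lambda}-1}=\sum_{k=0}^\infty\beta_k(\lambda)\dfrac{t^k}{k!}$. Binomial coefficients $\binom{a}{b}$ vanish for $b>a$ or $b<0$; sums whose upper limit is below the lower limit are empty and equal $0$. -}

module Defs where

open import Level using (Level; _⊔_) renaming (suc to lsuc)
open import Algebra.Bundles using (CommutativeRing)
open import Data.Nat as ℕ using (ℕ; zero; suc; _∸_; _<_)
open import Data.Nat.Combinatorics using (_C_)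
open import Data.Nat using (_!)
open import Data.Integer as ℤ using (ℤ; +_; -[1+_])
open import Data.Rational as ℚ using (ℚ; mkℚ; _/_)
open import Data.List as L using (List; []; _∷_; _++_; map; upTo; foldr; zipWith; replicate)
open import Relation.Nullary using (¬_)

record Field (c ℓ : Level) : Set (lsuc (c ⊔ ℓ)) where
  field
    commutativeRing : CommutativeRing c ℓ
  open CommutativeRing commutativeRing public
  field
    _⁻¹        : Carrier → Carrier
    ⁻¹-inverse : ∀ x → ¬ (x ≈ 0#) → x * (x ⁻¹) ≈ 1#
    0≉1        : ¬ (0# ≈ 1#)

module FieldOps {c ℓ : Level} (K : Field c ℓ) where
  open Field K

  pow : Carrier → ℕ → Carrier
  pow x zero    = 1#
  pow x (suc k) = x * pow x k

  natCast : ℕ → Carrier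
  natCast zero    = 0#
  natCast (suc k) = 1# + natCast k

  intCast : ℤ → Carrier
  intCast (+ k)      = natCast k
  intCast -[1+ k ]   = - natCast (suc k)

  CharZero : Set ℓ
  CharZero = ∀ k → ¬ (natCast (suc k) ≈ 0#)

  -- the canonical embedding ℚ → K (meaningful in characteristic zero)
  ι : ℚ → Carrier
  ι (mkℚ num den-1 _) = intCast num * (natCast (suc den-1) ⁻¹)

  IsPrimitiveRoot : Carrier → ℕ → Set ℓ
  IsPrimitiveRoot ζ n = (pow ζ n ≈ 1#) × (∀ i → 0 < i → i < n → ¬ (pow ζ i ≈ 1#))
    where open import Data.Product using (_×_)

  sumK : List Carrier → Carrier
  sumK = foldr _+_ 0#

  prodK : List Carrier → Carrier
  prodK = foldr _*_ 1#

  choose : ℕ → List ℕ → List (List ℕ)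
  choose zero    xs       = [] ∷ []
  choose (suc m) []       = []
  choose (suc m) (x ∷ xs) = map (x ∷_) (choose m xs) ++ choose (suc m) xs

  oneTo : ℕ → List ℕ
  oneTo n = map suc (upTo (n ∸ 1))

  Zeta : ℕ → Carrier → List ℕ → Carrier
  Zeta n ζ s =
    sumK (map (λ is → prodK (zipWith (λ i sk → pow ((1# - pow ζ i) ⁻¹) sk) is s))
              (choose (L.length s) (oneTo n)))

  twosWith : ℕ → ℕ → ℕ → List ℕ
  twosWith m j A = replicate (j ∸ 1) 2 ++ (A ∷ replicate (m ∸ j) 2)

  LHS : ℕ → ℕ → Carrier → ℕ → Carrier
  LHS n m ζ A = sumK (map (λ j → Zeta n ζ (twosWith m j A)) (map suc (upTo m)))

sumℚ : List ℚ → ℚ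
sumℚ = foldr ℚ._+_ ℚ.0ℚ

-- 1/k for k ≥ 1 (and, as a harmless convention, 0 for k = 0; it is only
-- ever applied to positive k below)
recip : ℕ → ℚ
recip zero    = ℚ.0ℚ
recip (suc k) = + 1 / suc k

natℚ : ℕ → ℚ
natℚ k = + k / 1

sgn : ℕ → ℚ
sgn zero    = ℚ.1ℚ
sgn (suc e) = ℚ.- sgn e

-- Degenerate Bernoulli numbers (Carlitz):
--   t / ((1 + λ t)^{1/λ} - 1) = Σ β_k(λ) t^k / k!
-- As formal power series, (1 + λ t)^{1/λ} = Σ_i c_i t^i with
--   c_i = Π_{r=0}^{i-1} (1 - r λ) / i!,
-- so ((1 + λ t)^{1/λ} - 1)/t = Σ_i d_i t^i with d_i = c_{i+1}, d_0 = 1,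
-- and b_k = β_k(λ)/k! satisfies b_0 = 1, b_k = - Σ_{i=1}^k d_i b_{k-i}.

prodℚ : List ℚ → ℚ
prodℚ = foldr ℚ._*_ ℚ.1ℚ

cCoeff : ℚ → ℕ → ℚ
cCoeff λ' i = prodℚ (map (λ r → ℚ.1ℚ ℚ.- natℚ r ℚ.* λ') (upTo i)) ℚ.* recip (i !)

dCoeff : ℚ → ℕ → ℚ
dCoeff λ' i = cCoeff λ' (suc i)

-- bList λ k = b_k ∷ b_{k-1} ∷ … ∷ b_0
bList : ℚ → ℕ → List ℚ
bList λ' zero    = ℚ.1ℚ ∷ []
bList λ' (suc k) =
  (ℚ.- sumℚ (zipWith ℚ._*_ (map (λ i → dCoeff λ' (suc i)) (upTo (suc k))) (bList λ' k)))
  ∷ bList λ' k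

headℚ : List ℚ → ℚ
headℚ []      = ℚ.0ℚ
headℚ (x ∷ _) = x

β : ℕ → ℚ → ℚ
β k λ' = natℚ (k !) ℚ.* headℚ (bList λ' k)

innerTerm : ℕ → ℕ → ℕ → ℕ → ℚ
innerTerm n m A k =
  sumℚ (map (λ j →
      sgn (suc k) ℚ.* natℚ (n ℕ.^ j) ℚ.* β j (recip n)
        ℚ.* recip (n ℕ.* (m ℕ.+ k ℕ.+ 1) ℕ.* (j !))
        ℚ.* natℚ ((A ∸ 2 ℕ.* k ∸ 3) C (j ∸ 1))
        ℚ.* (natℚ ((n ∸ 1) C (m ℕ.+ k))
               ℚ.+ sgn (m ℕ.+ k) ℚ.* natℚ ((n ∸ 1) C (2 ℕ.* m ℕ.+ 2 ℕ.* k ℕ.+ 1))))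
    (map suc (upTo (A ∸ 2 ℕ.* k ∸ 2))))

-- A = 2a, a ≥ 1 : k ranges over 0 … a-2
RHSeven : ℕ → ℕ → ℕ → ℚ
RHSeven n m a =
  sumℚ (map (innerTerm n m (2 ℕ.* a)) (upTo (a ∸ 1)))
  ℚ.+ sgn (a ∸ 1) ℚ.* natℚ (m ℕ.+ a ∸ 1) ℚ.* recip (n ℕ.* (m ℕ.+ a))
      ℚ.* (natℚ ((n ∸ 1) C (m ℕ.+ a ∸ 1))
             ℚ.+ sgn (m ℕ.+ a ∸ 1) ℚ.* natℚ ((n ∸ 1) C (2 ℕ.* m ℕ.+ 2 ℕ.* a ∸ 1)))

-- A = 2a+1, a ≥ 0 : k ranges over 0 … a-1 ( = (A-3)/2 ); note
-- m + (A-3)/2 = m + a - 1 ≥ 0 since m ≥ 1.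
RHSodd : ℕ → ℕ → ℕ → ℚ
RHSodd n m a =
  sumℚ (map (innerTerm n m (2 ℕ.* a ℕ.+ 1)) (upTo a))
  ℚ.+ sgn a ℚ.* recip n
      ℚ.* (natℚ ((n ∸ 1) C (m ℕ.+ a))
             ℚ.+ sgn (m ℕ.+ a ∸ 1) ℚ.* natℚ ((n ∸ 1) C (2 ℕ.* m ℕ.+ 2 ℕ.* a)))

{-# OPTIONS --safe #-}
module Submission where

-- Put x_i = 1/(1 - ζ^i) for 0 < i < n. The left-hand side is Σ_i x_i^A e_{m-1}(x_k² : k ≠ i),
-- and splitting e_m(x²) according to whether i occurs gives
--   Σ_i x_i^{A+2} e_{m-1}(x_k² : k ≠ i) = p_A e_m(x²) - Σ_i x_i^A e_m(x_k² : k ≠ i),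
-- with p_A = Σ_i x_i^A, which reduces A to 1 or 2. Since (x_i - 1)^n = x_i^n, Vieta gives
-- ∏ (1 + x_i T) = ((1 + T)^n - 1)/(nT) =: P(T); then P(T) P(-T) and P'(T) P(-T) yield e_m(x²)
-- and the case A = 1. The degenerate Bernoulli numbers are the coefficients of 1/P. The numbers
-- 1 - x_i have the same generating polynomial P, and the partial fractions of 1/P over them read
-- n^j β_j(1/n)/j! = - Σ_i x_i (x_i - 1)^{j-1} for j ≥ 1, so that the binomial sum over j is -p_s.

open import Defs
open import Level using (Level)
open import Algebra.Solver.Ring.AlmostCommutativeRing
  using (fromCommutativeRing; _-Raw-AlmostCommutative⟶_)
import Algebra.Properties.Ring as RingProperties
import Algebra.Properties.CommutativeSemigroup as CommutativeSemigroupProperties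
import Algebra.Solver.Ring as RingSolver
import Data.Nat as ℕ
import Data.Nat.Properties as ℕₚ
open ℕ using (ℕ; zero; suc; _!)
open import Data.Nat.Combinatorics using (_C_; nCk+nC[k+1]≡[n+1]C[k+1]; k>n⇒nCk≡0; nC1≡n)
open import Data.Nat.Tactic.RingSolver using (solve-∀)
import Data.Integer as ℤ
import Data.Integer.Properties as ℤₚ
open ℤ using (ℤ; +_; -[1+_])
import Data.Rational as ℚ
import Data.Rational.Properties as ℚₚ
open ℚ using (ℚ)
import Data.Rational.Unnormalised as ℚᵘ
open ℚᵘ using (ℚᵘ; mkℚᵘ)
open import Data.List using (List; []; _∷_; _++_; map; length; applyUpTo; replicate; upTo; zipWith)
open import Data.List.Properties using (map-∘; map-upTo; length-applyUpTo; length-replicate)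
open import Data.List.Relation.Unary.All as All using (All; []; _∷_)
import Data.List.Relation.Unary.All.Properties as Allₚ
open import Data.List.Relation.Unary.AllPairs using (AllPairs; []; _∷_)
import Data.List.Relation.Unary.AllPairs.Properties as AllPairsₚ
open import Data.Maybe using (Maybe; just; nothing)
open import Data.Product using (_×_; _,_; proj₁; proj₂)
open import Data.Unit using (tt)
open import Function using (_∘_)
open import Relation.Nullary using (¬_; yes; no)
import Relation.Binary.PropositionalEquality as ≡
open ≡ using (_≡_)

-- Generating functions are handled as coefficient sequences, so dividing by `T` is an index shift:
-- both factors of a product like `(1 + T)^n (1 - T)^n` have constant term 1, and stripping these
-- leaves the convolution of the shifted series. The series that stands in for `P'` is `Σ_i ∏_{k≠i}
-- (1 + x_k T) = (n-1) P - T P' = ((1 + T)^(n-1) - 1)/T`; it serves both the case `A =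
-- 1` and the partial fractions of `1/P`. The numbers `1 -
-- x_i` are the `x_i` in another order, since `1 - x_i` belongs to `ζ^(-i)`. Expanding `1/P` over
-- them makes the binomial sum produce powers of `x_i` directly; expanding over the `x_i` would
-- produce powers of `1 - x_i` and call for a permutation of the indices. The brackets in the
-- statement are `n (M + 1) e_M(x²)`. The last term for even `A` is, up to sign, `M e_M(x²)` with
-- `M = m + A/2 - 1`, because the case `A = 2` counts each monomial of `e_M` once for each of its
-- variables.

-- Integers inside the field, and a ring solver with integer coefficients

module Casts {c ℓ : Level} (K : Field c ℓ) where
  open Field K hiding (zero)
  open FieldOps K
  open RingProperties ring
  open import Relation.Binary.Reasoning.Setoid setoid

  natCast-+ : ∀ m n → natCast (m ℕ.+ n) ≈ natCast m + natCast n
  natCast-+ zero    n = sym (+-identityˡ _)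
  natCast-+ (suc m) n = trans (+-congˡ (natCast-+ m n)) (sym (+-assoc _ _ _))

  natCast-* : ∀ m n → natCast (m ℕ.* n) ≈ natCast m * natCast n
  natCast-* zero    n = sym (zeroˡ _)
  natCast-* (suc m) n = begin
    natCast (n ℕ.+ m ℕ.* n)               ≈⟨ natCast-+ n (m ℕ.* n) ⟩
    natCast n + natCast (m ℕ.* n)         ≈⟨ +-cong (sym (*-identityˡ _)) (natCast-* m n) ⟩
    1# * natCast n + natCast m * natCast n ≈⟨ distribʳ _ _ _ ⟨
    (1# + natCast m) * natCast n          ∎

  intCast-⊖ : ∀ m n → intCast (m ℤ.⊖ n) ≈ natCast m - natCast n
  intCast-⊖ zero    zero    = sym (-‿inverseʳ 0#)
  intCast-⊖ zero    (suc n) = sym (+-identityˡ _)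
  intCast-⊖ (suc m) zero    = sym (trans (+-congˡ -0#≈0#) (+-identityʳ _))
  intCast-⊖ (suc m) (suc n) = begin
    intCast (suc m ℤ.⊖ suc n)             ≡⟨ ≡.cong intCast (ℤₚ.[1+m]⊖[1+n]≡m⊖n m n) ⟩
    intCast (m ℤ.⊖ n)                     ≈⟨ intCast-⊖ m n ⟩
    natCast m - natCast n                 ≈⟨ +-identityˡ _ ⟨
    0# + (natCast m - natCast n)          ≈⟨ +-congʳ (-‿inverseʳ 1#) ⟨
    (1# - 1#) + (natCast m - natCast n)   ≈⟨ interchange _ _ _ _ ⟩
    (1# + natCast m) + (- 1# - natCast n) ≈⟨ +-congˡ (-‿+-comm _ _) ⟩
    (1# + natCast m) - (1# + natCast n)   ∎
    where open CommutativeSemigroupProperties +-commutativeSemigroup using (interchange)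

  intCast-neg : ∀ i → intCast (ℤ.- i) ≈ - intCast i
  intCast-neg (+ zero)  = sym -0#≈0#
  intCast-neg (+ suc n) = refl
  intCast-neg -[1+ n ]  = sym (-‿involutive _)

  intCast-+ : ∀ i j → intCast (i ℤ.+ j) ≈ intCast i + intCast j
  intCast-+ (+ m)    (+ n)    = natCast-+ m n
  intCast-+ (+ m)    -[1+ n ] = intCast-⊖ m (suc n)
  intCast-+ -[1+ m ] (+ n)    = trans (intCast-⊖ n (suc m)) (+-comm _ _)
  intCast-+ -[1+ m ] -[1+ n ] = begin
    - natCast (suc (suc (m ℕ.+ n)))       ≡⟨ ≡.cong (λ k → - natCast (suc k)) (ℕₚ.+-suc m n) ⟨
    - natCast (suc m ℕ.+ suc n)           ≈⟨ -‿cong (natCast-+ (suc m) (suc n)) ⟩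
    - (natCast (suc m) + natCast (suc n)) ≈⟨ -‿+-comm _ _ ⟨
    - natCast (suc m) - natCast (suc n)   ∎

  intCast-pos-* : ∀ m j → intCast (+ m ℤ.* j) ≈ natCast m * intCast j
  intCast-pos-* m (+ n) = begin
    intCast (+ m ℤ.* + n)   ≡⟨ ≡.cong intCast (ℤₚ.pos-* m n) ⟨
    natCast (m ℕ.* n)       ≈⟨ natCast-* m n ⟩
    natCast m * natCast n   ∎
  intCast-pos-* m -[1+ n ] = begin
    intCast (+ m ℤ.* ℤ.- (+ suc n))   ≡⟨ ≡.cong intCast (ℤₚ.neg-distribʳ-* (+ m) (+ suc n)) ⟨
    intCast (ℤ.- (+ m ℤ.* + suc n))   ≈⟨ intCast-neg (+ m ℤ.* + suc n) ⟩
    - intCast (+ m ℤ.* + suc n)       ≈⟨ -‿cong (intCast-pos-* m (+ suc n)) ⟩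
    - (natCast m * natCast (suc n))   ≈⟨ -‿distribʳ-* _ _ ⟩
    natCast m * - natCast (suc n)     ∎

  intCast-* : ∀ i j → intCast (i ℤ.* j) ≈ intCast i * intCast j
  intCast-* (+ m)    j = intCast-pos-* m j
  intCast-* -[1+ m ] j = begin
    intCast (ℤ.- (+ suc m) ℤ.* j)     ≡⟨ ≡.cong intCast (ℤₚ.neg-distribˡ-* (+ suc m) j) ⟨
    intCast (ℤ.- (+ suc m ℤ.* j))     ≈⟨ intCast-neg (+ suc m ℤ.* j) ⟩
    - intCast (+ suc m ℤ.* j)         ≈⟨ -‿cong (intCast-pos-* (suc m) j) ⟩
    - (natCast (suc m) * intCast j)   ≈⟨ -‿distribˡ-* _ _ ⟩
    - natCast (suc m) * intCast j     ∎

  -- Agrees with intCast, but evaluates 1 to 1# itself rather than to 1# + 0#,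
  -- so that the solver recognises 1#.
  coeff : ℤ → Carrier
  coeff (+ 1) = 1#
  coeff i     = intCast i

  coeff≈intCast : ∀ i → coeff i ≈ intCast i
  coeff≈intCast (+ 0)           = refl
  coeff≈intCast (+ 1)           = sym (+-identityʳ 1#)
  coeff≈intCast (+ suc (suc n)) = refl
  coeff≈intCast -[1+ n ]        = refl

  coeff-morphism : ℤ.+-*-rawRing -Raw-AlmostCommutative⟶ fromCommutativeRing commutativeRing
  coeff-morphism = record
    { ⟦_⟧    = coeff
    ; +-homo = λ i j → trans (coeff≈intCast (i ℤ.+ j)) (trans (intCast-+ i j)
                 (sym (+-cong (coeff≈intCast i) (coeff≈intCast j))))
    ; *-homo = λ i j → trans (coeff≈intCast (i ℤ.* j)) (trans (intCast-* i j)
                 (sym (*-cong (coeff≈intCast i) (coeff≈intCast j))))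
    ; -‿homo = λ i → trans (coeff≈intCast (ℤ.- i)) (trans (intCast-neg i)
                 (sym (-‿cong (coeff≈intCast i))))
    ; 0-homo = refl
    ; 1-homo = refl
    }

  _coeff≟_ : ∀ i j → Maybe (coeff i ≈ coeff j)
  i coeff≟ j with i ℤ.≟ j
  ... | yes i≡j = just (reflexive (≡.cong coeff i≡j))
  ... | no  _   = nothing

  open RingSolver ℤ.+-*-rawRing (fromCommutativeRing commutativeRing) coeff-morphism _coeff≟_
    public using (solve; _:=_; _:+_; _:*_; _:-_; :-_; con)

-- Formal power series as coefficient sequences

module Series {c ℓ : Level} (K : Field c ℓ) where
  open Field K hiding (zero)
  open FieldOps K
  open Casts K
  open import Relation.Binary.Reasoning.Setoid setoid

  infix  4 _≋_
  infixl 7 _⊛_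

  _≋_ : (ℕ → Carrier) → (ℕ → Carrier) → Set ℓ
  c ≋ d = ∀ k → c k ≈ d k

  δ : ℕ → Carrier
  δ zero    = 1#
  δ (suc _) = 0#

  -- c(T) ↦ (1 + a T) c(T)
  lin : Carrier → (ℕ → Carrier) → ℕ → Carrier
  lin a c zero    = c zero
  lin a c (suc k) = c (suc k) + a * c k

  -- c(T) ↦ c(T²)
  up : (ℕ → Carrier) → ℕ → Carrier
  up c zero          = c zero
  up c (suc zero)    = 0#
  up c (suc (suc k)) = up (c ∘ suc) k

  -- c(T) ↦ T c(T)
  raise : (ℕ → Carrier) → ℕ → Carrier
  raise c zero    = 0#
  raise c (suc k) = c k

  _⊛_ : (ℕ → Carrier) → (ℕ → Carrier) → ℕ → Carrier
  (c ⊛ d) zero    = c zero * d zero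
  (c ⊛ d) (suc k) = c zero * d (suc k) + ((c ∘ suc) ⊛ d) k

  lin-cong : ∀ {a b c d} → a ≈ b → c ≋ d → lin a c ≋ lin b d
  lin-cong a≈b c≋d zero    = c≋d zero
  lin-cong a≈b c≋d (suc k) = +-cong (c≋d (suc k)) (*-cong a≈b (c≋d k))

  lin-+ : ∀ a c d → lin a (λ k → c k + d k) ≋ (λ k → lin a c k + lin a d k)
  lin-+ a c d zero    = refl
  lin-+ a c d (suc k) = solve 5 (λ a c d c′ d′ →
    c′ :+ d′ :+ a :* (c :+ d) := (c′ :+ a :* c) :+ (d′ :+ a :* d)) refl a (c k) (d k) _ _

  lin-raise : ∀ a c → lin a (raise c) ≋ raise (lin a c)
  lin-raise a c zero          = refl
  lin-raise a c (suc zero)    = solve 2 (λ a c → c :+ a :* con (+ 0) := c) refl a (c 0)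
  lin-raise a c (suc (suc k)) = refl

  ⊛-cong : ∀ {c c′ d d′} → c ≋ c′ → d ≋ d′ → c ⊛ d ≋ c′ ⊛ d′
  ⊛-cong p q zero    = *-cong (p 0) (q 0)
  ⊛-cong p q (suc k) = +-cong (*-cong (p 0) (q (suc k))) (⊛-cong (p ∘ suc) q k)

  ⊛-distribʳ : ∀ c c′ d → (λ k → c k + c′ k) ⊛ d ≋ (λ k → (c ⊛ d) k + (c′ ⊛ d) k)
  ⊛-distribʳ c c′ d zero    = distribʳ _ _ _
  ⊛-distribʳ c c′ d (suc k) = trans (+-congˡ (⊛-distribʳ (c ∘ suc) (c′ ∘ suc) d k))
    (solve 5 (λ c c′ d p q → (c :+ c′) :* d :+ (p :+ q) := (c :* d :+ p) :+ (c′ :* d :+ q))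
      refl (c 0) (c′ 0) (d (suc k)) _ _)

  ⊛-distribˡ : ∀ c d d′ → c ⊛ (λ k → d k + d′ k) ≋ (λ k → (c ⊛ d) k + (c ⊛ d′) k)
  ⊛-distribˡ c d d′ zero    = distribˡ _ _ _
  ⊛-distribˡ c d d′ (suc k) = trans (+-congˡ (⊛-distribˡ (c ∘ suc) d d′ k))
    (solve 5 (λ c d d′ p q → c :* (d :+ d′) :+ (p :+ q) := (c :* d :+ p) :+ (c :* d′ :+ q))
      refl (c 0) (d (suc k)) (d′ (suc k)) _ _)

  ⊛-scaleˡ : ∀ a c d → (λ k → a * c k) ⊛ d ≋ (λ k → a * (c ⊛ d) k)
  ⊛-scaleˡ a c d zero    = *-assoc _ _ _
  ⊛-scaleˡ a c d (suc k) = trans (+-congˡ (⊛-scaleˡ a (c ∘ suc) d k))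
    (solve 4 (λ a c d p → a :* c :* d :+ a :* p := a :* (c :* d :+ p)) refl a (c 0) (d (suc k)) _)

  ⊛-scaleʳ : ∀ a c d → c ⊛ (λ k → a * d k) ≋ (λ k → a * (c ⊛ d) k)
  ⊛-scaleʳ a c d zero    = solve 3 (λ a c d → c :* (a :* d) := a :* (c :* d)) refl a (c 0) (d 0)
  ⊛-scaleʳ a c d (suc k) = trans (+-congˡ (⊛-scaleʳ a (c ∘ suc) d k))
    (solve 4 (λ a c d p → c :* (a :* d) :+ a :* p := a :* (c :* d :+ p)) refl a (c 0) (d (suc k)) _)

  ⊛-zeroˡ : ∀ d → (λ _ → 0#) ⊛ d ≋ (λ _ → 0#)
  ⊛-zeroˡ d zero    = zeroˡ _
  ⊛-zeroˡ d (suc k) = trans (+-cong (zeroˡ _) (⊛-zeroˡ d k)) (+-identityˡ _)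

  ⊛-zeroʳ : ∀ c → c ⊛ (λ _ → 0#) ≋ (λ _ → 0#)
  ⊛-zeroʳ c zero    = zeroʳ _
  ⊛-zeroʳ c (suc k) = trans (+-cong (zeroʳ _) (⊛-zeroʳ (c ∘ suc) k)) (+-identityˡ _)

  ⊛-identityˡ : ∀ d → δ ⊛ d ≋ d
  ⊛-identityˡ d zero    = *-identityˡ _
  ⊛-identityˡ d (suc k) = trans (+-cong (*-identityˡ _) (⊛-zeroˡ d k)) (+-identityʳ _)

  ⊛-identityʳ : ∀ c → c ⊛ δ ≋ c
  ⊛-identityʳ c zero    = *-identityʳ _
  ⊛-identityʳ c (suc k) = trans (+-cong (zeroʳ _) (⊛-identityʳ (c ∘ suc) k)) (+-identityˡ _)

  -- The recursion of `⊛` consumes its left argument; this is the mirror image, needed to strip the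
  -- constant term of the right one.
  ⊛-sucʳ : ∀ c d k → (c ⊛ d) (suc k) ≈ c (suc k) * d 0 + (c ⊛ (d ∘ suc)) k
  ⊛-sucʳ c d zero    = +-comm _ _
  ⊛-sucʳ c d (suc k) = trans (+-congˡ (⊛-sucʳ (c ∘ suc) d k))
    (solve 3 (λ x y z → x :+ (y :+ z) := y :+ (x :+ z)) refl _ _ _)

  ⊛-linˡ : ∀ a c d → lin a c ⊛ d ≋ lin a (c ⊛ d)
  ⊛-linˡ a c d zero    = refl
  ⊛-linˡ a c d (suc k) = begin
    c 0 * d (suc k) + ((λ i → c (suc i) + a * c i) ⊛ d) k
      ≈⟨ +-congˡ (trans (⊛-distribʳ (c ∘ suc) (λ i → a * c i) d k) (+-congˡ (⊛-scaleˡ a c d k))) ⟩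
    c 0 * d (suc k) + (((c ∘ suc) ⊛ d) k + a * (c ⊛ d) k)
      ≈⟨ +-assoc _ _ _ ⟨
    lin a (c ⊛ d) (suc k) ∎

  -- With `⊛-linˡ`, an induction over a list can pull one linear factor out of each argument, so
  -- products over lists are multiplied factor by factor.
  ⊛-linʳ : ∀ a c d → c ⊛ lin a d ≋ lin a (c ⊛ d)
  ⊛-linʳ a c d zero          = refl
  ⊛-linʳ a c d (suc zero)    = solve 5 (λ a c c′ d d′ →
    c :* (d′ :+ a :* d) :+ c′ :* d := (c :* d′ :+ c′ :* d) :+ a :* (c :* d)) refl a (c 0) (c 1) (d 0) (d 1)
  ⊛-linʳ a c d (suc (suc k)) = trans (+-congˡ (⊛-linʳ a (c ∘ suc) d (suc k)))
    (solve 6 (λ a c d d′ p q →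
      c :* (d′ :+ a :* d) :+ (p :+ a :* q) := (c :* d′ :+ p) :+ a :* (c :* d :+ q))
      refl a (c 0) (d (suc k)) (d (suc (suc k))) _ _)

  -- Power series with constant term 1 are cancellable.
  ⊛-cancelˡ : ∀ c d d′ → c 0 ≈ 1# → c ⊛ d ≋ c ⊛ d′ → d ≋ d′
  ⊛-cancelˡ c d d′ c₀≈1 eq k = below (suc k) k ℕₚ.≤-refl
    where
    unit : ∀ x → c 0 * x ≈ x
    unit x = trans (*-congʳ c₀≈1) (*-identityˡ x)

    agree : ∀ c k → (∀ i → i ℕ.< k → d i ≈ d′ i) → ∀ j → j ℕ.< k → (c ⊛ d) j ≈ (c ⊛ d′) j
    agree c k ih zero    j<k = *-congˡ (ih 0 j<k)
    agree c k ih (suc j) j<k = +-cong (*-congˡ (ih (suc j) j<k))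
      (agree (c ∘ suc) k ih j (ℕₚ.<-trans (ℕₚ.n<1+n j) j<k))

    step : ∀ k → (∀ i → i ℕ.< k → d i ≈ d′ i) → d k ≈ d′ k
    step zero    ih = trans (sym (unit _)) (trans (eq 0) (unit _))
    step (suc k) ih = begin
      d (suc k)   ≈⟨ solve 2 (λ x p → x := x :+ p :- p) refl _ (((c ∘ suc) ⊛ d) k) ⟩
      d (suc k) + ((c ∘ suc) ⊛ d) k - ((c ∘ suc) ⊛ d) k
        ≈⟨ +-cong (+-congʳ (sym (unit _))) (-‿cong (agree (c ∘ suc) (suc k) ih k (ℕₚ.n<1+n k))) ⟩
      (c ⊛ d) (suc k) - ((c ∘ suc) ⊛ d′) k
        ≈⟨ +-congʳ (trans (eq (suc k)) (+-congʳ (unit _))) ⟩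
      d′ (suc k) + ((c ∘ suc) ⊛ d′) k - ((c ∘ suc) ⊛ d′) k
        ≈⟨ solve 2 (λ x p → x :+ p :- p := x) refl _ _ ⟩
      d′ (suc k)  ∎

    -- Course-of-values induction: apart from `c 0 * d k`, coefficient `k` of the product involves
    -- every earlier coefficient of `d`.
    below : ∀ k i → i ℕ.< k → d i ≈ d′ i
    below (suc k) i (ℕ.s≤s i≤k) = step i (λ j j<i → below k j (ℕₚ.<-≤-trans j<i i≤k))

  up-cong : ∀ {c d} → c ≋ d → up c ≋ up d
  up-cong p zero          = p 0
  up-cong p (suc zero)    = refl
  up-cong p (suc (suc k)) = up-cong (p ∘ suc) k

  up-+ : ∀ c d → up (λ k → c k + d k) ≋ (λ k → up c k + up d k)
  up-+ c d zero          = refl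
  up-+ c d (suc zero)    = sym (+-identityˡ _)
  up-+ c d (suc (suc k)) = up-+ (c ∘ suc) (d ∘ suc) k

  up-scale : ∀ a c → up (λ k → a * c k) ≋ (λ k → a * up c k)
  up-scale a c zero          = refl
  up-scale a c (suc zero)    = sym (zeroʳ _)
  up-scale a c (suc (suc k)) = up-scale a (c ∘ suc) k

  up-zero : ∀ k → up (λ _ → 0#) k ≈ 0#
  up-zero zero          = refl
  up-zero (suc zero)    = refl
  up-zero (suc (suc k)) = up-zero k

  up-δ : up δ ≋ δ
  up-δ zero          = refl
  up-δ (suc zero)    = refl
  up-δ (suc (suc k)) = up-zero k

  up-even : ∀ c k → up c (k ℕ.+ k) ≈ c k
  up-even c zero    = refl
  up-even c (suc k) = trans (reflexive (≡.cong (up c ∘ suc) (ℕₚ.+-suc k k))) (up-even (c ∘ suc) k)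

  up-odd : ∀ c k → up c (suc (k ℕ.+ k)) ≈ 0#
  up-odd c zero    = refl
  up-odd c (suc k) = trans (reflexive (≡.cong (up c ∘ suc ∘ suc) (ℕₚ.+-suc k k))) (up-odd (c ∘ suc) k)

  -- Since `(1 + a T)(1 - a T) = 1 - a² T²` is a polynomial in `T²`, the pair of factors moves under
  -- `up` as a single one.
  lin-lin-up : ∀ a c → lin a (lin (- a) (up c)) ≋ up (lin (- (a * a)) c)
  lin-lin-up a c zero       = refl
  lin-lin-up a c (suc zero) = solve 2 (λ a c → (con (+ 0) :+ :- a :* c) :+ a :* c := con (+ 0)) refl a (c 0)
  lin-lin-up a c (suc (suc k)) = begin
    up (c ∘ suc) k + - a * up c (suc k) + a * lin (- a) (up c) (suc k)
      ≈⟨ solve 4 (λ a p q r → p :+ :- a :* q :+ a :* (q :+ :- a :* r) := p :+ :- (a :* a) :* r)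
           refl a (up (c ∘ suc) k) (up c (suc k)) (up c k) ⟩
    up (c ∘ suc) k + - (a * a) * up c k
      ≈⟨ +-congˡ (up-scale (- (a * a)) c k) ⟨
    up (c ∘ suc) k + up (λ i → - (a * a) * c i) k
      ≈⟨ up-+ (c ∘ suc) (λ i → - (a * a) * c i) k ⟨
    up (λ i → c (suc i) + - (a * a) * c i) k  ∎

-- Elementary symmetric functions with one distinguished variable

module Symmetric {c ℓ : Level} (K : Field c ℓ) {A : Set} where
  open Field K hiding (zero)
  open FieldOps K
  open Casts K
  open Series K
  open import Relation.Binary.Reasoning.Setoid setoid

  elem : (A → Carrier) → List A → ℕ → Carrier
  elem f []      = δ
  elem f (x ∷ L) = lin (f x) (elem f L)

  -- marked w f L k = Σ_{x ∈ L} w(x) e_k(f on L ∖ {x})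
  marked : (w f : A → Carrier) → List A → ℕ → Carrier
  marked w f []      k = 0#
  marked w f (x ∷ L) k = w x * elem f L k + lin (f x) (marked w f L) k

  sumOver : (A → Carrier) → List A → Carrier
  sumOver w L = sumK (map w L)

  elem-cong : ∀ {f g} → (∀ x → f x ≈ g x) → ∀ L → elem f L ≋ elem g L
  elem-cong p []      k = refl
  elem-cong p (x ∷ L) k = lin-cong (p x) (elem-cong p L) k

  marked-cong : ∀ {v w f g} → (∀ x → v x ≈ w x) → (∀ x → f x ≈ g x) →
    ∀ L → marked v f L ≋ marked w g L
  marked-cong p q []      k = refl
  marked-cong p q (x ∷ L) k =
    +-cong (*-cong (p x) (elem-cong q L k)) (lin-cong (q x) (marked-cong p q L) k)

  elem-0 : ∀ f L → elem f L 0 ≈ 1#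
  elem-0 f []      = refl
  elem-0 f (x ∷ L) = elem-0 f L

  elem-neg : ∀ f L k → elem (λ x → - f x) L k ≈ pow (- 1#) k * elem f L k
  elem-neg f []      zero    = sym (*-identityˡ _)
  elem-neg f []      (suc k) = sym (zeroʳ _)
  elem-neg f (x ∷ L) zero    = elem-neg f L 0
  elem-neg f (x ∷ L) (suc k) = trans (+-cong (elem-neg f L (suc k)) (*-congˡ (elem-neg f L k)))
    (solve 4 (λ a s p q → (:- con (+ 1) :* s) :* p :+ :- a :* (s :* q)
                       := (:- con (+ 1) :* s) :* (p :+ a :* q)) refl (f x) (pow (- 1#) k) _ _)

  marked-neg : ∀ w f L k → marked w (λ x → - f x) L k ≈ pow (- 1#) k * marked w f L k
  marked-neg w f []      k       = sym (zeroʳ _)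
  marked-neg w f (x ∷ L) zero    = trans (+-cong (*-congˡ (elem-neg f L 0)) (marked-neg w f L 0))
    (solve 3 (λ a p q → a :* (con (+ 1) :* p) :+ con (+ 1) :* q := con (+ 1) :* (a :* p :+ q)) refl _ _ _)
  marked-neg w f (x ∷ L) (suc k) = trans
    (+-cong (*-congˡ (elem-neg f L (suc k)))
            (+-cong (marked-neg w f L (suc k)) (*-congˡ (marked-neg w f L k))))
    (solve 6 (λ b a s p q r →
       b :* ((:- con (+ 1) :* s) :* p) :+ ((:- con (+ 1) :* s) :* q :+ :- a :* (s :* r))
       := (:- con (+ 1) :* s) :* (b :* p :+ (q :+ a :* r))) refl (w x) (f x) (pow (- 1#) k) _ _ _)

  marked-negˡ : ∀ w f L k → marked (λ x → - w x) f L k ≈ - marked w f L k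
  marked-negˡ w f []      k    = solve 0 (con (+ 0) := :- con (+ 0)) refl
  marked-negˡ w f (x ∷ L) zero = trans (+-congˡ (marked-negˡ w f L 0))
    (solve 3 (λ a p q → :- a :* p :+ :- q := :- (a :* p :+ q)) refl _ _ _)
  marked-negˡ w f (x ∷ L) (suc k) =
    trans (+-congˡ (+-cong (marked-negˡ w f L (suc k)) (*-congˡ (marked-negˡ w f L k))))
    (solve 5 (λ a p q b r → :- a :* p :+ (:- q :+ b :* :- r) := :- (a :* p :+ (q :+ b :* r))) refl _ _ _ _ _)

  sum*elem-0 : ∀ w f L → sumOver w L * elem f L 0 ≈ marked w f L 0
  sum*elem-0 w f []      = zeroˡ _
  sum*elem-0 w f (x ∷ L) = trans (distribʳ _ _ _) (+-congˡ (sum*elem-0 w f L))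

  -- In w(x) e_{k+1}(f on L), split e_{k+1} according to whether f(x) occurs.
  sum*elem-suc : ∀ w f L k → sumOver w L * elem f L (suc k)
    ≈ marked w f L (suc k) + marked (λ x → w x * f x) f L k
  sum*elem-suc w f []      k = solve 0 (con (+ 0) :* con (+ 0) := con (+ 0) :+ con (+ 0)) refl
  sum*elem-suc w f (x ∷ L) k = begin
    (w x + W) * (e (suc k) + f x * e k)
      ≈⟨ solve 5 (λ w W f e₁ e₀ → (w :+ W) :* (e₁ :+ f :* e₀)
           := w :* e₁ :+ (f :* w :* e₀ :+ (W :* e₁ :+ f :* (W :* e₀)))) refl (w x) W (f x) (e (suc k)) (e k) ⟩
    w x * e (suc k) + (f x * w x * e k + (W * e (suc k) + f x * (W * e k)))
      ≈⟨ +-congˡ (+-congˡ (+-congʳ (sum*elem-suc w f L k))) ⟩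
    w x * e (suc k) + (f x * w x * e k + (M (suc k) + N k + f x * (W * e k)))
      ≈⟨ rest k ⟩
    w x * e (suc k) + lin (f x) M (suc k) + (w x * f x * e k + lin (f x) N k) ∎
    where
    W = sumOver w L
    e = elem f L
    M = marked w f L
    N = marked (λ x → w x * f x) f L
    rest : ∀ k → w x * e (suc k) + (f x * w x * e k + (M (suc k) + N k + f x * (W * e k)))
      ≈ w x * e (suc k) + lin (f x) M (suc k) + (w x * f x * e k + lin (f x) N k)
    rest zero    = trans (+-congˡ (+-congˡ (+-congˡ (*-congˡ (sum*elem-0 w f L)))))
      (solve 7 (λ w f e₁ e₀ m₁ n m₀ → w :* e₁ :+ (f :* w :* e₀ :+ (m₁ :+ n :+ f :* m₀))
         := w :* e₁ :+ (m₁ :+ f :* m₀) :+ (w :* f :* e₀ :+ n)) refl _ _ _ _ _ _ _)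
    rest (suc k) = trans (+-congˡ (+-congˡ (+-congˡ (*-congˡ (sum*elem-suc w f L k)))))
      (solve 8 (λ w f e₁ e₀ m₁ n m₀ n₀ → w :* e₁ :+ (f :* w :* e₀ :+ (m₁ :+ n :+ f :* (m₀ :+ n₀)))
         := w :* e₁ :+ (m₁ :+ f :* m₀) :+ (w :* f :* e₀ :+ (n :+ f :* n₀))) refl _ _ _ _ _ _ _ _)

  -- Each monomial of `e_{k+1}` arises once for every choice of its marked variable. With `f` a
  -- square this is the base case `A = 2`.
  marked-self : ∀ f L k → marked f f L k ≈ natCast (suc k) * elem f L (suc k)
  marked-self f []      k       = sym (zeroʳ _)
  marked-self f (x ∷ L) zero    = trans (+-congˡ (marked-self f L 0))
    (solve 3 (λ a e₀ e₁ → a :* e₀ :+ (con (+ 1) :+ con (+ 0)) :* e₁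
       := (con (+ 1) :+ con (+ 0)) :* (e₁ :+ a :* e₀)) refl _ _ _)
  marked-self f (x ∷ L) (suc k) = trans
    (+-congˡ (+-cong (marked-self f L (suc k)) (*-congˡ (marked-self f L k))))
    (solve 4 (λ a c e₁ e₂ → a :* e₁ :+ ((con (+ 1) :+ c) :* e₂ :+ a :* (c :* e₁))
       := (con (+ 1) :+ c) :* (e₂ :+ a :* e₁)) refl (f x) (natCast (suc k)) _ _)

  elem⊛elem-neg : ∀ f L → elem f L ⊛ elem (λ x → - f x) L ≋ up (elem (λ x → - (f x * f x)) L)
  elem⊛elem-neg f []      k = trans (⊛-identityˡ δ k) (sym (up-δ k))
  elem⊛elem-neg f (x ∷ L) k = begin
    (lin (f x) (elem f L) ⊛ lin (- f x) (elem (λ x → - f x) L)) k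
      ≈⟨ ⊛-linˡ (f x) (elem f L) _ k ⟩
    lin (f x) (elem f L ⊛ lin (- f x) (elem (λ x → - f x) L)) k
      ≈⟨ lin-cong refl (λ i → trans (⊛-linʳ (- f x) (elem f L) _ i)
                                    (lin-cong refl (elem⊛elem-neg f L) i)) k ⟩
    lin (f x) (lin (- f x) (up (elem (λ x → - (f x * f x)) L))) k
      ≈⟨ lin-lin-up (f x) _ k ⟩
    up (elem (λ x → - (f x * f x)) (x ∷ L)) k ∎

  -- In the summand that omits `x`, every other factor pairs up to `1 - f² T²`, while `1 - f(x) T`
  -- stays unpaired. Its `1` gives the even part of the product and its `- f(x) T` the odd part,
  -- which therefore carries the weight `- f`.
  marked⊛elem-neg : ∀ f L → marked (λ _ → 1#) f L ⊛ elem (λ x → - f x) L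
    ≋ (λ k → up (marked (λ _ → 1#) (λ x → - (f x * f x)) L) k
           + raise (up (marked (λ x → - f x) (λ x → - (f x * f x)) L)) k)
  marked⊛elem-neg f []      k = trans (⊛-zeroˡ δ k) (sym (zeros k))
    where
    zeros : ∀ k → up (λ _ → 0#) k + raise (up (λ _ → 0#)) k ≈ 0#
    zeros zero    = +-identityˡ _
    zeros (suc k) = trans (+-cong (up-zero (suc k)) (up-zero k)) (+-identityˡ _)
  marked⊛elem-neg f (x ∷ L) k = begin
    ((λ i → 1# * e i + lin a M i) ⊛ lin (- a) e⁻) k
      ≈⟨ ⊛-linʳ (- a) (λ i → 1# * e i + lin a M i) e⁻ k ⟩
    lin (- a) ((λ i → 1# * e i + lin a M i) ⊛ e⁻) k
      ≈⟨ lin-cong refl (λ i → trans (⊛-distribʳ (λ j → 1# * e j) (lin a M) e⁻ i)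
           (+-cong (trans (⊛-cong {c′ = e} {d = e⁻} (λ _ → *-identityˡ _) (λ _ → refl) i) (elem⊛elem-neg f L i))
                   (trans (⊛-linˡ a M e⁻ i) (lin-cong refl (marked⊛elem-neg f L) i)))) k ⟩
    lin (- a) (λ i → up E² i + lin a (λ j → up P j + raise (up Q) j) i) k
      ≈⟨ lin-+ (- a) (up E²) _ k ⟩
    lin (- a) (up E²) k + lin (- a) (lin a (λ j → up P j + raise (up Q) j)) k
      ≈⟨ +-cong (lin-up k) (lin-lin k) ⟩
    up E² k + raise (λ j → - a * up E² j) k + (up (lin b P) k + raise (up (lin b Q)) k)
      ≈⟨ solve 4 (λ p q r s → p :+ q :+ (r :+ s) := (p :+ r) :+ (q :+ s)) refl _ _ _ _ ⟩
    (up E² k + up (lin b P) k) + (raise (λ j → - a * up E² j) k + raise (up (lin b Q)) k)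
      ≈⟨ +-cong (trans (+-congʳ (up-cong (λ i → sym (*-identityˡ _)) k)) (sym (up-+ (λ i → 1# * E² i) (lin b P) k))) (raises k) ⟩
    up (λ i → 1# * E² i + lin b P i) k + raise (up (λ i → - a * E² i + lin b Q i)) k ∎
    where
    a = f x
    b = - (f x * f x)
    e = elem f L
    e⁻ = elem (λ x → - f x) L
    E² = elem (λ x → - (f x * f x)) L
    M = marked (λ _ → 1#) f L
    P = marked (λ _ → 1#) (λ x → - (f x * f x)) L
    Q = marked (λ x → - f x) (λ x → - (f x * f x)) L
    lin-up : ∀ k → lin (- a) (up E²) k ≈ up E² k + raise (λ j → - a * up E² j) k
    lin-up zero    = sym (+-identityʳ _)
    lin-up (suc k) = refl
    lin-swap : ∀ c → lin (- a) (lin a c) ≋ lin a (lin (- a) c)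
    lin-swap c zero          = refl
    lin-swap c (suc zero)    = solve 3 (λ a p q → p :+ a :* q :+ :- a :* q := p :+ :- a :* q :+ a :* q) refl a (c 1) (c 0)
    lin-swap c (suc (suc k)) = solve 4 (λ a p q r → p :+ a :* q :+ :- a :* (q :+ a :* r)
      := p :+ :- a :* q :+ a :* (q :+ :- a :* r)) refl a (c (suc (suc k))) (c (suc k)) (c k)
    raise-cong : ∀ {c d} → c ≋ d → raise c ≋ raise d
    raise-cong p zero    = refl
    raise-cong p (suc k) = p k
    lin-lin : ∀ k → lin (- a) (lin a (λ j → up P j + raise (up Q) j)) k
      ≈ up (lin b P) k + raise (up (lin b Q)) k
    lin-lin k = begin
      lin (- a) (lin a (λ j → up P j + raise (up Q) j)) k
        ≈⟨ lin-swap _ k ⟩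
      lin a (lin (- a) (λ j → up P j + raise (up Q) j)) k
        ≈⟨ lin-cong refl (λ i → trans (lin-+ (- a) (up P) (raise (up Q)) i) (+-congˡ (lin-raise (- a) (up Q) i))) k ⟩
      lin a (λ i → lin (- a) (up P) i + raise (lin (- a) (up Q)) i) k
        ≈⟨ lin-+ a _ _ k ⟩
      lin a (lin (- a) (up P)) k + lin a (raise (lin (- a) (up Q))) k
        ≈⟨ +-cong (lin-lin-up a P k) (trans (lin-raise a _ k) (raise-cong (lin-lin-up a Q) k)) ⟩
      up (lin b P) k + raise (up (lin b Q)) k ∎
    raises : ∀ k → raise (λ j → - a * up E² j) k + raise (up (lin b Q)) k
      ≈ raise (up (λ i → - a * E² i + lin b Q i)) k
    raises zero    = +-identityˡ _
    raises (suc k) = trans (+-congʳ (sym (up-scale (- a) E² k))) (sym (up-+ (λ i → - a * E² i) (lin b Q) k))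

  geometric-inverse : ∀ a → lin (- a) (pow a) ≋ δ
  geometric-inverse a zero    = refl
  geometric-inverse a (suc k) = solve 2 (λ a p → a :* p :+ :- a :* p := con (+ 0)) refl a (pow a k)

  -- Σ_i ∏_{k≠i} (1 + f_k T) = ∏_k (1 + f_k T) · Σ_i 1 / (1 + f_i T)
  elem⊛powerSums : ∀ f L → elem f L ⊛ (λ k → sumOver (λ x → pow (- f x) k) L) ≋ marked (λ _ → 1#) f L
  elem⊛powerSums f []      k = ⊛-zeroʳ δ k
  elem⊛powerSums f (x ∷ L) k = begin
    (lin a e ⊛ (λ i → pow (- a) i + S i)) k
      ≈⟨ ⊛-distribˡ (lin a e) (pow (- a)) S k ⟩
    (lin a e ⊛ pow (- a)) k + (lin a e ⊛ S) k
      ≈⟨ +-cong (trans (⊛-linˡ a e (pow (- a)) k) (sym (⊛-linʳ a e (pow (- a)) k))) (⊛-linˡ a e S k) ⟩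
    (e ⊛ lin a (pow (- a))) k + lin a (e ⊛ S) k
      ≈⟨ +-cong (⊛-cong {c = e} (λ _ → refl) (λ i → trans (lin-cong (sym (-‿involutive a)) (λ _ → refl) i) (geometric-inverse (- a) i)) k)
                (lin-cong refl (elem⊛powerSums f L) k) ⟩
    (e ⊛ δ) k + lin a (marked (λ _ → 1#) f L) k
      ≈⟨ +-congʳ (trans (⊛-identityʳ e k) (sym (*-identityˡ _))) ⟩
    1# * e k + lin a (marked (λ _ → 1#) f L) k ∎
    where
    open import Algebra.Properties.Ring ring using (-‿involutive)
    a = f x
    e = elem f L
    S = λ k → sumOver (λ x → pow (- f x) k) L

-- Binomial coefficients, finite sums and binomial transforms

module Binomial {c ℓ : Level} (K : Field c ℓ) where
  open Field K hiding (zero)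
  open FieldOps K
  open Casts K
  open Series K
  open Symmetric K
  open import Relation.Binary.Reasoning.Setoid setoid

  binom : ℕ → ℕ → Carrier
  binom n k = natCast (n C k)

  pascal : ∀ n k → binom (suc n) (suc k) ≈ binom n k + binom n (suc k)
  pascal n k = trans (reflexive (≡.cong natCast (≡.sym (nCk+nC[k+1]≡[n+1]C[k+1] n k))))
    (natCast-+ (n C k) (n C suc k))

  binom-vanish : ∀ {n k} → n ℕ.< k → binom n k ≈ 0#
  binom-vanish n<k = reflexive (≡.cong natCast (k>n⇒nCk≡0 n<k))

  binom-one : ∀ n → binom n 1 ≈ natCast n
  binom-one n = reflexive (≡.cong natCast (nC1≡n n))

  -- Trades the upper index `n` of the Vieta coefficients for the `n - 1` of the theorem, at the
  -- price of a factor `n` that can be cancelled.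
  absorption : ∀ n k → natCast (suc k) * binom (suc n) (suc k) ≈ natCast (suc n) * binom n k
  absorption n zero = begin
    (1# + 0#) * binom (suc n) 1   ≈⟨ *-congˡ (binom-one (suc n)) ⟩
    (1# + 0#) * natCast (suc n)   ≈⟨ *-comm _ _ ⟩
    natCast (suc n) * (1# + 0#)   ∎
  absorption zero (suc k) = trans
    (*-congˡ (binom-vanish {1} {suc (suc k)} (ℕ.s≤s (ℕ.s≤s ℕ.z≤n))))
    (trans (zeroʳ _) (sym (trans (*-congˡ (binom-vanish {0} {suc k} (ℕ.s≤s ℕ.z≤n))) (zeroʳ _))))
  absorption (suc n) (suc k) = begin
    natCast (suc (suc k)) * binom (suc (suc n)) (suc (suc k))
      ≈⟨ *-congˡ (pascal (suc n) (suc k)) ⟩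
    natCast (suc (suc k)) * (p + q)
      ≈⟨ solve 3 (λ k p q → (con (+ 1) :+ k) :* (p :+ q) := p :+ (k :* p :+ (con (+ 1) :+ k) :* q)) refl (natCast (suc k)) p q ⟩
    p + (natCast (suc k) * p + natCast (suc (suc k)) * q)
      ≈⟨ +-congˡ (+-cong (absorption n k) (absorption n (suc k))) ⟩
    p + (natCast (suc n) * binom n k + natCast (suc n) * binom n (suc k))
      ≈⟨ +-congˡ (trans (sym (distribˡ _ _ _)) (*-congˡ (sym (pascal n k)))) ⟩
    p + natCast (suc n) * p
      ≈⟨ solve 2 (λ p n → p :+ n :* p := (con (+ 1) :+ n) :* p) refl p (natCast (suc n)) ⟩
    natCast (suc (suc n)) * p ∎
    where
    p = binom (suc n) (suc k)
    q = binom (suc n) (suc (suc k))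

  -- The coefficients of `(1 - T)^n`.
  alt : ℕ → ℕ → Carrier
  alt n k = pow (- 1#) k * binom n k

  elem-one : ∀ {A : Set} (L : List A) → elem (λ _ → 1#) L ≋ binom (length L)
  elem-one []      zero    = sym (+-identityʳ 1#)
  elem-one []      (suc k) = sym (binom-vanish {0} {suc k} (ℕ.s≤s ℕ.z≤n))
  elem-one (x ∷ L) zero    = elem-one L 0
  elem-one (x ∷ L) (suc k) = begin
    elem (λ _ → 1#) L (suc k) + 1# * elem (λ _ → 1#) L k
      ≈⟨ +-cong (elem-one L (suc k)) (trans (*-identityˡ _) (elem-one L k)) ⟩
    binom (length L) (suc k) + binom (length L) k   ≈⟨ +-comm _ _ ⟩
    binom (length L) k + binom (length L) (suc k)   ≈⟨ pascal (length L) k ⟨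
    binom (suc (length L)) (suc k)                  ∎

  -- `(1 + T)^n (1 - T)^n = (1 - T²)^n`, obtained from `elem⊛elem-neg` with all variables equal to
  -- 1; the list `L` of units only encodes the exponent.
  binom⊛alt : ∀ n → binom n ⊛ alt n ≋ up (alt n)
  binom⊛alt n = ≡.subst (λ n → binom n ⊛ alt n ≋ up (alt n)) (length-replicate n) (λ k → begin
    (binom (length L) ⊛ alt (length L)) k
      ≈⟨ ⊛-cong (λ i → sym (elem-one L i)) (λ i → sym (trans (elem-neg (λ _ → 1#) L i) (*-congˡ (elem-one L i)))) k ⟩
    (elem (λ _ → 1#) L ⊛ elem (λ _ → - 1#) L) k
      ≈⟨ elem⊛elem-neg (λ _ → 1#) L k ⟩
    up (elem (λ _ → - (1# * 1#)) L) k
      ≈⟨ up-cong (λ i → trans (elem-cong (λ _ → -‿cong (*-identityˡ 1#)) L i)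
                   (trans (elem-neg (λ _ → 1#) L i) (*-congˡ (elem-one L i)))) k ⟩
    up (alt (length L)) k ∎)
    where L = replicate n tt

  -- (1 + T)^n (1 - T)^{n+1} = (1 - T) (1 - T²)^n
  binom⊛alt-suc : ∀ n → binom n ⊛ alt (suc n) ≋ lin (- 1#) (up (alt n))
  binom⊛alt-suc n k = begin
    (binom n ⊛ alt (suc n)) k            ≈⟨ ⊛-cong {c = binom n} (λ _ → refl) alt-suc k ⟩
    (binom n ⊛ lin (- 1#) (alt n)) k     ≈⟨ ⊛-linʳ (- 1#) (binom n) (alt n) k ⟩
    lin (- 1#) (binom n ⊛ alt n) k       ≈⟨ lin-cong refl (binom⊛alt n) k ⟩
    lin (- 1#) (up (alt n)) k            ∎
    where
    alt-suc : alt (suc n) ≋ lin (- 1#) (alt n)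
    alt-suc zero    = refl
    alt-suc (suc k) = trans (*-congˡ (pascal n k))
      (solve 3 (λ s p q → :- con (+ 1) :* s :* (p :+ q)
         := :- con (+ 1) :* s :* q :+ :- con (+ 1) :* (s :* p)) refl (pow (- 1#) k) _ _)

  pow-neg-one-even : ∀ m → pow (- 1#) (m ℕ.+ m) ≈ 1#
  pow-neg-one-even zero    = refl
  pow-neg-one-even (suc m) = trans
    (reflexive (≡.cong (λ k → - 1# * pow (- 1#) k) (ℕₚ.+-suc m m)))
    (trans (solve 1 (λ p → :- con (+ 1) :* (:- con (+ 1) :* p) := p) refl _) (pow-neg-one-even m))

  pow-neg-one-square : ∀ m → pow (- 1#) m * pow (- 1#) m ≈ 1#
  pow-neg-one-square zero    = *-identityˡ 1#
  pow-neg-one-square (suc m) = trans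
    (solve 1 (λ s → :- con (+ 1) :* s :* (:- con (+ 1) :* s) := s :* s) refl _) (pow-neg-one-square m)

  *-cancelˡ-nonzero : ∀ a {x y} → ¬ (a ≈ 0#) → a * x ≈ a * y → x ≈ y
  *-cancelˡ-nonzero a {x} {y} a≉0 ax≈ay = trans (sym (unscale x)) (trans (*-congˡ ax≈ay) (unscale y))
    where
    unscale : ∀ x → a ⁻¹ * (a * x) ≈ x
    unscale x = trans (sym (*-assoc _ _ _))
      (trans (*-congʳ (trans (*-comm _ _) (⁻¹-inverse a a≉0))) (*-identityˡ x))

  sum< : ℕ → (ℕ → Carrier) → Carrier
  sum< k g = sumK (applyUpTo g k)

  sum<-cong : ∀ k {g h} → (∀ i → i ℕ.< k → g i ≈ h i) → sum< k g ≈ sum< k h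
  sum<-cong zero    p = refl
  sum<-cong (suc k) p = +-cong (p 0 (ℕ.s≤s ℕ.z≤n)) (sum<-cong k (λ i i<k → p (suc i) (ℕ.s≤s i<k)))

  sum<-+ : ∀ k g h → sum< k (λ i → g i + h i) ≈ sum< k g + sum< k h
  sum<-+ zero    g h = sym (+-identityˡ _)
  sum<-+ (suc k) g h = trans (+-congˡ (sum<-+ k (g ∘ suc) (h ∘ suc)))
    (solve 4 (λ a b p q → a :+ b :+ (p :+ q) := a :+ p :+ (b :+ q)) refl _ _ _ _)

  sum<-scale : ∀ a k g → sum< k (λ i → a * g i) ≈ a * sum< k g
  sum<-scale a zero    g = sym (zeroʳ a)
  sum<-scale a (suc k) g = trans (+-congˡ (sum<-scale a k (g ∘ suc))) (sym (distribˡ _ _ _))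

  sum<-sucʳ : ∀ k g → sum< (suc k) g ≈ sum< k g + g k
  sum<-sucʳ zero    g = +-comm _ _
  sum<-sucʳ (suc k) g = trans (+-congˡ (sum<-sucʳ k (g ∘ suc))) (sym (+-assoc _ _ _))

  -- The operator `(1 + E)^s`, with `E` the shift of sequences, read at index 0. In this form
  -- linearity and the action on geometric sequences are plain inductions.
  binomialTransform : ℕ → (ℕ → Carrier) → Carrier
  binomialTransform zero    g = g 0
  binomialTransform (suc s) g = binomialTransform s g + binomialTransform s (g ∘ suc)

  binomialTransform-sum : ∀ s g → binomialTransform s g ≈ sum< (suc s) (λ j → binom s j * g j)
  binomialTransform-sum zero    g = solve 1 (λ x → x := (con (+ 1) :+ con (+ 0)) :* x :+ con (+ 0)) refl (g 0)
  binomialTransform-sum (suc s) g = begin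
    binomialTransform s g + binomialTransform s (g ∘ suc)
      ≈⟨ +-cong (binomialTransform-sum s g) (binomialTransform-sum s (g ∘ suc)) ⟩
    sum< (suc s) (λ j → binom s j * g j) + sum< (suc s) p
      ≈⟨ +-congʳ (trans (sym (trans (+-congˡ (trans (*-congʳ (binom-vanish (ℕₚ.n<1+n s))) (zeroˡ _)))
           (+-identityʳ _))) (sym (sum<-sucʳ (suc s) (λ j → binom s j * g j)))) ⟩
    binom s 0 * g 0 + sum< (suc s) q + sum< (suc s) p
      ≈⟨ trans (+-assoc _ _ _) (+-cong refl (trans (+-comm _ _) (sym (sum<-+ (suc s) p q)))) ⟩
    binom s 0 * g 0 + sum< (suc s) (λ j → p j + q j)
      ≈⟨ +-congˡ (sum<-cong (suc s) (λ j _ → trans (sym (distribʳ (g (suc j)) _ _)) (*-congʳ (sym (pascal s j))))) ⟩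
    sum< (suc (suc s)) (λ j → binom (suc s) j * g j) ∎
    where
    p = λ j → binom s j * g (suc j)
    q = λ j → binom s (suc j) * g (suc j)

  binomialTransform-cong : ∀ s {g h} → g ≋ h → binomialTransform s g ≈ binomialTransform s h
  binomialTransform-cong zero    p = p 0
  binomialTransform-cong (suc s) p = +-cong (binomialTransform-cong s p) (binomialTransform-cong s (p ∘ suc))

  -- Geometric sequences are eigenvectors of the shift. The first term `a` must be arbitrary because
  -- shifting replaces it by `a * u`.
  binomialTransform-geometric : ∀ s a u → binomialTransform s (λ j → a * pow u j) ≈ a * pow (1# + u) s
  binomialTransform-geometric zero    a u = refl
  binomialTransform-geometric (suc s) a u = begin
    binomialTransform s (λ j → a * pow u j) + binomialTransform s (λ j → a * (u * pow u j))
      ≈⟨ +-cong (binomialTransform-geometric s a u)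
           (trans (binomialTransform-cong s (λ j → sym (*-assoc _ _ _))) (binomialTransform-geometric s (a * u) u)) ⟩
    a * pow (1# + u) s + a * u * pow (1# + u) s
      ≈⟨ solve 3 (λ a u p → a :* p :+ a :* u :* p := a :* ((con (+ 1) :+ u) :* p)) refl a u _ ⟩
    a * pow (1# + u) (suc s) ∎

  binomialTransform-sumOver : ∀ {A : Set} s (h : A → ℕ → Carrier) (L : List A) →
    binomialTransform s (λ j → sumOver (λ x → h x j) L) ≈ sumOver (λ x → binomialTransform s (h x)) L
  binomialTransform-sumOver zero    h L       = refl
  binomialTransform-sumOver (suc s) h L = trans
    (+-cong (binomialTransform-sumOver s h L) (binomialTransform-sumOver s (λ x → h x ∘ suc) L))
    (sumOver-+ L)
    where
    sumOver-+ : ∀ {f g} L → sumOver f L + sumOver g L ≈ sumOver (λ x → f x + g x) L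
    sumOver-+ []      = +-identityˡ _
    sumOver-+ (x ∷ L) = trans
      (solve 4 (λ a p b q → a :+ p :+ (b :+ q) := a :+ b :+ (p :+ q)) refl _ _ _ _)
      (+-congˡ (sumOver-+ L))

-- Vieta's formulas by synthetic division

module Roots {c ℓ : Level} (K : Field c ℓ) where
  open Field K hiding (zero)
  open FieldOps K
  open Casts K
  open Series K
  open Symmetric K
  open Binomial K
  open import Relation.Binary.Reasoning.Setoid setoid

  -- horner c t d = c_0 t^d + c_1 t^{d-1} + … + c_d, and the values horner c t k
  -- with k < d are the coefficients of the quotient by (u - t).
  horner : (ℕ → Carrier) → Carrier → ℕ → Carrier
  horner c t zero    = c zero
  horner c t (suc k) = c (suc k) + t * horner c t k

  horner-difference : ∀ c t u d →
    horner c u (suc d) - horner c t (suc d) ≈ (u - t) * horner (horner c t) u d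
  horner-difference c t u zero    = solve 4 (λ c₀ c₁ t u →
    c₁ :+ u :* c₀ :- (c₁ :+ t :* c₀) := (u :- t) :* c₀) refl (c 0) (c 1) t u
  horner-difference c t u (suc d) = begin
    c (suc (suc d)) + u * p - (c (suc (suc d)) + t * q)
      ≈⟨ solve 5 (λ c u t p q → c :+ u :* p :- (c :+ t :* q) := u :* (p :- q) :+ (u :- t) :* q)
           refl (c (suc (suc d))) u t p q ⟩
    u * (p - q) + (u - t) * q
      ≈⟨ +-congʳ (*-congˡ (horner-difference c t u d)) ⟩
    u * ((u - t) * horner (horner c t) u d) + (u - t) * q
      ≈⟨ solve 4 (λ u t r q → u :* ((u :- t) :* r) :+ (u :- t) :* q := (u :- t) :* (q :+ u :* r)) refl u t _ q ⟩
    (u - t) * horner (horner c t) u (suc d) ∎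
    where
    p = horner c u (suc d)
    q = horner c t (suc d)

  -- Divide by `u + f x` and recurse on the quotient. Coefficients are listed from the leading one,
  -- so the roots `- f x` become the series factors `1 + f(x) T`; the vanishing tail expresses the
  -- bound on the degree.
  vieta : ∀ {A : Set} (f : A → Carrier) (L : List A) c →
    AllPairs (λ x y → ¬ (f x ≈ f y)) L →
    All (λ x → horner c (- f x) (length L) ≈ 0#) L →
    (∀ k → c (suc (length L ℕ.+ k)) ≈ 0#) →
    ∀ k → c k ≈ c 0 * elem f L k
  vieta f []      c _ _ tail zero    = sym (*-identityʳ _)
  vieta f []      c _ _ tail (suc k) = trans (tail k) (sym (zeroʳ _))
  vieta f (x ∷ L) c (x≉ ∷ distinct) (root ∷ roots) tail = coeffs
    where
    q = horner c (- f x)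

    -- The first of these values is the remainder, zero because `- f x` is a root; each later one is
    -- a vanishing coefficient plus a multiple of its predecessor.
    q-tail : ∀ k → q (suc (length L ℕ.+ k)) ≈ 0#
    q-tail zero    = trans (reflexive (≡.cong (q ∘ suc) (ℕₚ.+-identityʳ _))) root
    q-tail (suc k) = trans (reflexive (≡.cong (q ∘ suc) (ℕₚ.+-suc (length L) k)))
      (trans (+-cong (tail k) (trans (*-congˡ (q-tail k)) (zeroʳ _))) (+-identityˡ _))

    -- The list is generalised to `L′` so that it can shrink while the degree remains tied to `L`.
    -- Distinctness makes `- f y - - f x` cancellable.
    q-roots : ∀ {L′} → All (λ y → ¬ (f x ≈ f y)) L′ → All (λ y → horner c (- f y) (suc (length L)) ≈ 0#) L′ →
      All (λ y → horner q (- f y) (length L) ≈ 0#) L′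
    q-roots [] [] = []
    q-roots {y ∷ _} (x≉y ∷ x≉) (root-y ∷ roots) = *-cancelˡ-nonzero (- f y - - f x)
      (λ eq → x≉y (trans (solve 2 (λ x y → x := y :+ (:- y :- :- x)) refl (f x) (f y))
                          (trans (+-congˡ eq) (+-identityʳ _))))
      (begin
        (- f y - - f x) * horner q (- f y) (length L)
          ≈⟨ horner-difference c (- f x) (- f y) (length L) ⟨
        horner c (- f y) (suc (length L)) - horner c (- f x) (suc (length L))
          ≈⟨ +-cong root-y (-‿cong root) ⟩
        0# - 0#
          ≈⟨ solve 1 (λ a → con (+ 0) :- con (+ 0) := a :* con (+ 0)) refl (- f y - - f x) ⟩
        (- f y - - f x) * 0# ∎) ∷ q-roots x≉ roots

    q-elem : ∀ k → q k ≈ c 0 * elem f L k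
    q-elem = vieta f L q distinct (q-roots x≉ roots) q-tail

    coeffs : ∀ k → c k ≈ c 0 * elem f (x ∷ L) k
    coeffs zero    = q-elem 0
    coeffs (suc k) = begin
      c (suc k)   ≈⟨ solve 3 (λ c a q → c := c :+ :- a :* q :+ a :* q) refl (c (suc k)) (f x) (q k) ⟩
      q (suc k) + f x * q k  ≈⟨ +-cong (q-elem (suc k)) (*-congˡ (q-elem k)) ⟩
      c 0 * elem f L (suc k) + f x * (c 0 * elem f L k)
        ≈⟨ solve 4 (λ c p a q → c :* p :+ a :* (c :* q) := c :* (p :+ a :* q)) refl _ _ _ _ ⟩
      c 0 * elem f (x ∷ L) (suc k) ∎

  horner-cong : ∀ {c d} t → c ≋ d → horner c t ≋ horner d t
  horner-cong t p zero    = p 0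
  horner-cong t p (suc k) = +-cong (p (suc k)) (*-congˡ (horner-cong t p k))

  horner-+ : ∀ c d t k → horner (λ i → c i + d i) t k ≈ horner c t k + horner d t k
  horner-+ c d t zero    = refl
  horner-+ c d t (suc k) = trans (+-congˡ (*-congˡ (horner-+ c d t k)))
    (solve 5 (λ c d t p q → c :+ d :+ t :* (p :+ q) := c :+ t :* p :+ (d :+ t :* q)) refl _ _ _ _ _)

  horner-suc : ∀ c t k → horner c t (suc k) ≈ c 0 * pow t (suc k) + horner (c ∘ suc) t k
  horner-suc c t zero    = solve 3 (λ c₀ c₁ t → c₁ :+ t :* c₀ := c₀ :* (t :* con (+ 1)) :+ c₁) refl _ _ _
  horner-suc c t (suc k) = trans (+-congˡ (*-congˡ (horner-suc c t k)))
    (solve 5 (λ c₀ c t p q → c :+ t :* (c₀ :* p :+ q) := c₀ :* (t :* p) :+ (c :+ t :* q)) refl _ _ _ _ _)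

  horner-binom : ∀ u n → horner (binom n) u n ≈ pow (1# + u) n
  horner-binom u zero    = +-identityʳ 1#
  horner-binom u (suc n) = begin
    horner (binom (suc n)) u (suc n)
      ≈⟨ horner-suc (binom (suc n)) u n ⟩
    binom n 0 * pow u (suc n) + horner (binom (suc n) ∘ suc) u n
      ≈⟨ +-congˡ (trans (horner-cong u (pascal n) n) (horner-+ (binom n) (binom n ∘ suc) u n)) ⟩
    binom n 0 * pow u (suc n) + (horner (binom n) u n + horner (binom n ∘ suc) u n)
      ≈⟨ solve 3 (λ p q r → p :+ (q :+ r) := q :+ (p :+ r)) refl _ _ _ ⟩
    horner (binom n) u n + (binom n 0 * pow u (suc n) + horner (binom n ∘ suc) u n)
      ≈⟨ +-congˡ (horner-suc (binom n) u n) ⟨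
    horner (binom n) u n + (binom n (suc n) + u * horner (binom n) u n)
      ≈⟨ +-cong (horner-binom u n) (+-cong (binom-vanish (ℕₚ.n<1+n n)) (*-congˡ (horner-binom u n))) ⟩
    pow (1# + u) n + (0# + u * pow (1# + u) n)
      ≈⟨ solve 2 (λ u p → p :+ (con (+ 0) :+ u :* p) := (con (+ 1) :+ u) :* p) refl u _ ⟩
    pow (1# + u) (suc n) ∎

  -- In `(1 + u)^n - u^n` the top terms cancel. The shift by `suc` drops that coefficient and leaves
  -- degree `n - 1` with leading coefficient `n`.
  horner-binom-root : ∀ u N → pow (1# + u) (suc N) ≈ pow u (suc N) → horner (binom (suc N) ∘ suc) u N ≈ 0#
  horner-binom-root u N eq = begin
    h                     ≈⟨ solve 2 (λ h p → h := (con (+ 1) :+ con (+ 0)) :* p :+ h :- p) refl h (pow u (suc N)) ⟩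
    binom (suc N) 0 * pow u (suc N) + h - pow u (suc N)
      ≈⟨ +-congʳ (trans (sym (horner-suc (binom (suc N)) u N)) (trans (horner-binom u (suc N)) eq)) ⟩
    pow u (suc N) - pow u (suc N)   ≈⟨ -‿inverseʳ _ ⟩
    0# ∎
    where h = horner (binom (suc N) ∘ suc) u N

  -- The equation `(1 - f)^n = (- f)^n` keeps its solutions under `f ↦ 1 - f`, which is why one
  -- lemma covers both families of nodes.
  elem-nodes : ∀ {A : Set} (f : A → Carrier) (L : List A) →
    AllPairs (λ x y → ¬ (f x ≈ f y)) L →
    All (λ x → pow (1# - f x) (suc (length L)) ≈ pow (- f x) (suc (length L))) L →
    ∀ k → natCast (suc (length L)) * elem f L k ≈ binom (suc (length L)) (suc k)
  elem-nodes f L distinct nodes k = sym (trans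
    (vieta f L (binom (suc (length L)) ∘ suc) distinct
      (All.map (λ {x} → horner-binom-root (- f x) (length L)) nodes)
      (λ k → binom-vanish (ℕ.s≤s (ℕ.s≤s (ℕₚ.m≤m+n (length L) k)))) k)
    (*-congʳ (binom-one (suc (length L)))))

-- Consequences of the generating polynomial P, for any family of nodes having it

module Nodes {c ℓ : Level} (K : Field c ℓ) (charZero : FieldOps.CharZero K)
  {A : Set} (f : A → Field.Carrier K) (L : List A) (N : ℕ) (length-L : length L ≡ N)
  (elem-f : ∀ k → Field._≈_ K
     (Field._*_ K (FieldOps.natCast K (suc N)) (Symmetric.elem K f L k))
     (FieldOps.natCast K (suc N C suc k))) where
  open Field K hiding (zero)
  open FieldOps K
  open Casts K
  open Series K
  open Symmetric K
  open Binomial K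
  open import Relation.Binary.Reasoning.Setoid setoid

  private
    n = natCast (suc N)
    f² : A → Carrier
    f² x = f x * f x

  sumOver-one : sumOver (λ _ → 1#) L ≈ natCast N
  sumOver-one = trans (count L) (reflexive (≡.cong natCast length-L))
    where
    count : ∀ L → sumOver {A} (λ _ → 1#) L ≈ natCast (length L)
    count []      = refl
    count (x ∷ L) = +-congˡ (count L)

  -- Marking one variable of weight 1 outside a monomial of degree `k` leaves `N - k` choices, so
  -- the value is `(N - k) e_k`, the coefficient of `N P - T P'`. The subtraction is obtained by
  -- splitting `N e_k` with `sum*elem-suc`, which forces the separate case `k = 0`.
  marked-one : marked (λ _ → 1#) f L ≋ binom N ∘ suc
  marked-one zero    = begin
    marked (λ _ → 1#) f L 0                ≈⟨ sum*elem-0 (λ _ → 1#) f L ⟨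
    sumOver (λ _ → 1#) L * elem f L 0      ≈⟨ *-cong (sumOver-one) (elem-0 f L) ⟩
    natCast N * 1#                         ≈⟨ *-identityʳ _ ⟩
    natCast N                              ≈⟨ binom-one N ⟨
    binom N 1                              ∎
  marked-one (suc k) = *-cancelˡ-nonzero n (charZero N) (begin
    n * M
      ≈⟨ *-congˡ (solve 2 (λ m p → m := m :+ p :- p) refl M (k′ * e)) ⟩
    n * (M + k′ * e - k′ * e)
      ≈⟨ *-congˡ (+-congʳ (trans (+-congˡ (sym (trans (marked-cong (λ x → *-identityˡ (f x)) (λ _ → refl) L k) (marked-self f L k))))
           (trans (sym (sum*elem-suc (λ _ → 1#) f L k)) (*-congʳ (sumOver-one))))) ⟩
    n * (natCast N * e - k′ * e)
      ≈⟨ solve 4 (λ n e N k → n :* (N :* e :- k :* e) := N :* (n :* e) :- k :* (n :* e)) refl n e (natCast N) k′ ⟩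
    natCast N * (n * e) - k′ * (n * e)
      ≈⟨ +-cong (*-congˡ (elem-f (suc k))) (-‿cong (*-congˡ (elem-f (suc k)))) ⟩
    natCast N * B - k′ * B
      ≈⟨ solve 3 (λ N k B → N :* B :- k :* B := (con (+ 1) :+ N) :* B :- (con (+ 1) :+ k) :* B) refl (natCast N) k′ B ⟩
    n * B - natCast (suc (suc k)) * B
      ≈⟨ +-cong (*-congˡ (pascal N (suc k))) (-‿cong (absorption N (suc k))) ⟩
    n * (binom N (suc k) + binom N (suc (suc k))) - n * binom N (suc k)
      ≈⟨ solve 3 (λ n p q → n :* (p :+ q) :- n :* p := n :* q) refl n _ _ ⟩
    n * binom N (suc (suc k)) ∎)
    where
    M = marked (λ _ → 1#) f L (suc k)
    e = elem f L (suc k)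
    k′ = natCast (suc k)
    B = binom (suc N) (suc (suc k))

  private
    alt-suc : alt (suc N) ∘ suc ≋ (λ i → - n * elem (λ x → - f x) L i)
    alt-suc i = begin
      - 1# * pow (- 1#) i * binom (suc N) (suc i)   ≈⟨ *-congˡ (elem-f i) ⟨
      - 1# * pow (- 1#) i * (n * elem f L i)
        ≈⟨ solve 3 (λ s n e → :- con (+ 1) :* s :* (n :* e) := :- n :* (s :* e)) refl (pow (- 1#) i) n (elem f L i) ⟩
      - n * (pow (- 1#) i * elem f L i)             ≈⟨ *-congˡ (elem-neg f L i) ⟨
      - n * elem (λ x → - f x) L i                  ∎

    -- Isolates the two end terms of the convolution, so that the rest is a product of series
    -- already divided by `T`.
    peel : ∀ c d k → (c ⊛ d) (suc (suc k)) ≈ c 0 * d (suc (suc k)) + (c (suc (suc k)) * d 0 + ((c ∘ suc) ⊛ (d ∘ suc)) k)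
    peel c d k = +-congˡ (⊛-sucʳ (c ∘ suc) d k)

  -- The coefficient of `T^(2m+2)` in `((1 + T)^n - 1)((1 - T)^n - 1) = - n² T² P(T)
  -- P(-T)`. In even degree `(1 + T)^n` and `(1 - T)^n` contribute equally, whence the factor 2.
  elem-square : ∀ m → n * n * elem f² L m
    ≈ binom (suc N) (suc m) + (1# + 1#) * (pow (- 1#) m * binom (suc N) (suc (suc (m ℕ.+ m))))
  elem-square m = begin
    n * n * e
      ≈⟨ trans (sym (*-identityˡ _)) (*-congʳ (sym (pow-neg-one-square m))) ⟩
    s * s * (n * n * e)
      -- The inserted `s * s`, equal to 1, and the added and subtracted `B₂ + B₂` expose the
      -- right-hand side of `key`.
      ≈⟨ solve 4 (λ s n e b → s :* s :* (n :* n :* e) := s :* ((b :+ b) :- (b :+ (b :+ :- n :* (n :* (s :* e)))))) refl s n e B₂ ⟩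
    s * ((B₂ + B₂) - (B₂ + (B₂ + - n * (n * (s * e)))))
      ≈⟨ *-congˡ (+-congˡ (-‿cong (sym key))) ⟩
    s * ((B₂ + B₂) - - 1# * s * B₁)
      ≈⟨ solve 3 (λ s a b → s :* ((a :+ a) :- :- con (+ 1) :* s :* b) := s :* s :* b :+ (con (+ 1) :+ con (+ 1)) :* (s :* a)) refl s B₂ B₁ ⟩
    s * s * B₁ + (1# + 1#) * (s * B₂)
      ≈⟨ +-congʳ (trans (*-congʳ (pow-neg-one-square m)) (*-identityˡ _)) ⟩
    B₁ + (1# + 1#) * (s * B₂) ∎
    where
    s = pow (- 1#) m
    e = elem f² L m
    B₁ = binom (suc N) (suc m)
    B₂ = binom (suc N) (suc (suc (m ℕ.+ m)))
    conv : ((binom (suc N) ∘ suc) ⊛ (alt (suc N) ∘ suc)) (m ℕ.+ m) ≈ - n * (n * (s * e))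
    conv = begin
      ((binom (suc N) ∘ suc) ⊛ (alt (suc N) ∘ suc)) (m ℕ.+ m)
        ≈⟨ ⊛-cong (λ i → sym (elem-f i)) alt-suc (m ℕ.+ m) ⟩
      ((λ i → n * elem f L i) ⊛ (λ i → - n * elem (λ x → - f x) L i)) (m ℕ.+ m)
        ≈⟨ trans (⊛-scaleʳ (- n) _ _ (m ℕ.+ m)) (*-congˡ (⊛-scaleˡ n _ _ (m ℕ.+ m))) ⟩
      - n * (n * (elem f L ⊛ elem (λ x → - f x) L) (m ℕ.+ m))
        ≈⟨ *-congˡ (*-congˡ (trans (elem⊛elem-neg f L (m ℕ.+ m)) (trans (up-even _ m) (elem-neg f² L m)))) ⟩
      - n * (n * (s * e)) ∎
    key : - 1# * s * B₁ ≈ B₂ + (B₂ + - n * (n * (s * e)))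
    key = begin
      alt (suc N) (suc m)
        ≈⟨ up-even (alt (suc N) ∘ suc) m ⟨
      up (alt (suc N)) (suc (suc (m ℕ.+ m)))
        ≈⟨ binom⊛alt (suc N) (suc (suc (m ℕ.+ m))) ⟨
      (binom (suc N) ⊛ alt (suc N)) (suc (suc (m ℕ.+ m)))
        ≈⟨ peel (binom (suc N)) (alt (suc N)) (m ℕ.+ m) ⟩
      binom (suc N) 0 * (- 1# * (- 1# * pow (- 1#) (m ℕ.+ m)) * B₂) + (B₂ * (1# * binom (suc N) 0) + _)
        ≈⟨ +-cong (*-congˡ (*-congʳ (*-congˡ (*-congˡ (pow-neg-one-even m))))) (+-congˡ conv) ⟩
      (1# + 0#) * (- 1# * (- 1# * 1#) * B₂) + (B₂ * (1# * (1# + 0#)) + - n * (n * (s * e)))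
        ≈⟨ solve 2 (λ b r → (con (+ 1) :+ con (+ 0)) :* (:- con (+ 1) :* (:- con (+ 1) :* con (+ 1)) :* b)
             :+ (b :* (con (+ 1) :* (con (+ 1) :+ con (+ 0))) :+ r) := b :+ (b :+ r)) refl B₂ _ ⟩
      B₂ + (B₂ + - n * (n * (s * e))) ∎

  -- The coefficient of `T^(2m+3)` in `(1 + T)^N (1 - T)^(N+1) = (1 - T)(1 - T²)^N`. Stripping
  -- constant terms leaves the odd index `2m + 1`, which selects the part of `marked⊛elem-neg` with
  -- weight `- f`; the end terms contribute `Q - (P + Q)`, so `Q` drops out.
  marked-square : ∀ m → n * marked f f² L m
    ≈ binom N (suc m) + pow (- 1#) m * binom N (suc (suc (m ℕ.+ m)))
  marked-square m = begin
    n * D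
      ≈⟨ trans (sym (*-identityˡ _)) (*-congʳ (sym (pow-neg-one-square m))) ⟩
    s * s * (n * D)
      ≈⟨ solve 5 (λ s n D p q → s :* s :* (n :* D) := s :* (:- (p :+ q) :+ (q :+ n :* (s :* D))) :+ s :* p) refl s n D P Q ⟩
    s * (- (P + Q) + (Q + n * (s * D))) + s * P
      ≈⟨ +-congʳ (*-congˡ (sym key)) ⟩
    s * (s * B) + s * P
      ≈⟨ +-congʳ (trans (sym (*-assoc _ _ _)) (trans (*-congʳ (pow-neg-one-square m)) (*-identityˡ _))) ⟩
    B + s * P ∎
    where
    s = pow (- 1#) m
    D = marked f f² L m
    B = binom N (suc m)
    P = binom N (suc (suc (m ℕ.+ m)))
    Q = binom N (suc (suc (suc (m ℕ.+ m))))
    conv : ((binom N ∘ suc) ⊛ (alt (suc N) ∘ suc)) (suc (m ℕ.+ m)) ≈ n * (s * D)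
    conv = begin
      ((binom N ∘ suc) ⊛ (alt (suc N) ∘ suc)) (suc (m ℕ.+ m))
        ≈⟨ ⊛-cong (λ i → sym (marked-one i)) alt-suc (suc (m ℕ.+ m)) ⟩
      (marked (λ _ → 1#) f L ⊛ (λ i → - n * elem (λ x → - f x) L i)) (suc (m ℕ.+ m))
        ≈⟨ ⊛-scaleʳ (- n) (marked (λ _ → 1#) f L) _ (suc (m ℕ.+ m)) ⟩
      - n * (marked (λ _ → 1#) f L ⊛ elem (λ x → - f x) L) (suc (m ℕ.+ m))
        ≈⟨ *-congˡ (trans (marked⊛elem-neg f L (suc (m ℕ.+ m)))
             (+-cong (up-odd _ m) (trans (up-even _ m)
               (trans (marked-negˡ f _ L m) (-‿cong (marked-neg f f² L m)))))) ⟩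
      - n * (0# + - (s * D))
        ≈⟨ solve 2 (λ n x → :- n :* (con (+ 0) :+ :- x) := n :* x) refl n (s * D) ⟩
      n * (s * D) ∎
    key : s * B ≈ - (P + Q) + (Q + n * (s * D))
    key = begin
      s * B
        ≈⟨ solve 2 (λ s b → s :* b := con (+ 0) :+ :- con (+ 1) :* (:- con (+ 1) :* s :* b)) refl s B ⟩
      0# + - 1# * alt N (suc m)
        ≈⟨ +-cong (up-odd (alt N ∘ suc) m) (*-congˡ (up-even (alt N ∘ suc) m)) ⟨
      lin (- 1#) (up (alt N)) (suc (suc (suc (m ℕ.+ m))))
        ≈⟨ binom⊛alt-suc N (suc (suc (suc (m ℕ.+ m)))) ⟨
      (binom N ⊛ alt (suc N)) (suc (suc (suc (m ℕ.+ m))))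
        ≈⟨ peel (binom N) (alt (suc N)) (suc (m ℕ.+ m)) ⟩
      binom N 0 * (- 1# * (- 1# * (- 1# * pow (- 1#) (m ℕ.+ m))) * binom (suc N) (suc (suc (suc (m ℕ.+ m)))))
        + (Q * (1# * binom (suc N) 0) + _)
        ≈⟨ +-cong (*-congˡ (*-cong (*-congˡ (*-congˡ (*-congˡ (pow-neg-one-even m)))) (pascal N _))) (+-congˡ conv) ⟩
      (1# + 0#) * (- 1# * (- 1# * (- 1# * 1#)) * (P + Q)) + (Q * (1# * (1# + 0#)) + n * (s * D))
        ≈⟨ solve 3 (λ p q r → (con (+ 1) :+ con (+ 0)) :* (:- con (+ 1) :* (:- con (+ 1) :* (:- con (+ 1) :* con (+ 1))) :* (p :+ q))
             :+ (q :* (con (+ 1) :* (con (+ 1) :+ con (+ 0))) :+ r) := :- (p :+ q) :+ (q :+ r)) refl P Q _ ⟩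
      - (P + Q) + (Q + n * (s * D)) ∎

  -- If b is the reciprocal of Σ e_k T^k, then b = n - (1 + T) Σ_x 1 / (1 + f(x) T).
  reciprocal-suc : ∀ b → elem f L ⊛ b ≋ δ →
    ∀ j → b (suc j) ≈ sumOver (λ x → (f x - 1#) * pow (- f x) j) L
  reciprocal-suc b eb≈δ j = begin
    b (suc j)
      ≈⟨ ⊛-cancelˡ (elem f L) b b′ (elem-0 f L) (λ k → trans (eb≈δ k) (sym (eb′≈δ k))) (suc j) ⟩
    n * 0# + - 1# * (S (suc j) + 1# * S j)
      ≈⟨ solve 3 (λ n p q → n :* con (+ 0) :+ :- con (+ 1) :* (p :+ con (+ 1) :* q) := :- (p :+ q)) refl n _ _ ⟩
    - (S (suc j) + S j)
      ≈⟨ combine L ⟩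
    sumOver (λ x → (f x - 1#) * pow (- f x) j) L ∎
    where
    S : ℕ → Carrier
    S k = sumOver (λ x → pow (- f x) k) L
    b′ : ℕ → Carrier
    b′ k = n * δ k + - 1# * lin 1# S k
    combine : ∀ L → - (sumOver (λ x → pow (- f x) (suc j)) L + sumOver (λ x → pow (- f x) j) L)
      ≈ sumOver (λ x → (f x - 1#) * pow (- f x) j) L
    combine []      = solve 0 (:- (con (+ 0) :+ con (+ 0)) := con (+ 0)) refl
    combine (x ∷ L) = trans
      (solve 4 (λ a p s t → :- (:- a :* p :+ s :+ (p :+ t)) := (a :- con (+ 1)) :* p :+ :- (s :+ t)) refl _ _ _ _)
      (+-congˡ (combine L))
    -- In closed form: `((1 + T)^n - 1)/T - (1 + T)((1 + T)^(n-1) - 1)/T = 1`.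
    values : ∀ k → n * elem f L k + - 1# * lin 1# (binom N ∘ suc) k ≈ δ k
    values zero    = trans (+-cong (*-congˡ (elem-0 f L)) (*-congˡ (binom-one N)))
      (solve 1 (λ N → (con (+ 1) :+ N) :* con (+ 1) :+ :- con (+ 1) :* N := con (+ 1)) refl (natCast N))
    values (suc k) = trans (+-congʳ (trans (elem-f (suc k)) (pascal N (suc k))))
      (solve 2 (λ p q → p :+ q :+ :- con (+ 1) :* (q :+ con (+ 1) :* p) := con (+ 0)) refl _ _)
    eb′≈δ : elem f L ⊛ b′ ≋ δ
    eb′≈δ k = begin
      (elem f L ⊛ b′) k
        ≈⟨ ⊛-distribˡ (elem f L) (λ i → n * δ i) (λ i → - 1# * lin 1# S i) k ⟩
      (elem f L ⊛ (λ i → n * δ i)) k + (elem f L ⊛ (λ i → - 1# * lin 1# S i)) k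
        ≈⟨ +-cong (trans (⊛-scaleʳ n _ δ k) (*-congˡ (⊛-identityʳ _ k)))
             (trans (⊛-scaleʳ (- 1#) _ _ k) (*-congˡ (trans (⊛-linʳ 1# _ S k)
               (lin-cong refl (λ i → trans (elem⊛powerSums f L i) (marked-one i)) k)))) ⟩
      n * elem f L k + - 1# * lin 1# (binom N ∘ suc) k
        ≈⟨ values k ⟩
      δ k ∎

-- The embedding of the rationals is a ring homomorphism

module Embedding {c ℓ : Level} (K : Field c ℓ) (charZero : FieldOps.CharZero K) where
  open Field K hiding (zero)
  open FieldOps K
  open Casts K
  open Binomial K
  open import Relation.Binary.Reasoning.Setoid setoid

  -- On unnormalised fractions the numerator and denominator of a sum or product are explicit, so
  -- the homomorphism laws follow by clearing denominators; reduction to lowest terms is absorbed by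
  -- `ιᵘ-cong`.
  ιᵘ : ℚᵘ → Carrier
  ιᵘ (mkℚᵘ num den-1) = intCast num * (natCast (suc den-1) ⁻¹)

  ιᵘ-numerator : ∀ p → natCast (ℚᵘ.↧ₙ p) * ιᵘ p ≈ intCast (ℚᵘ.↥ p)
  ιᵘ-numerator (mkℚᵘ num den-1) = trans
    (solve 3 (λ d a i → d :* (a :* i) := a :* (d :* i)) refl _ _ _)
    (trans (*-congˡ (⁻¹-inverse _ (charZero den-1))) (*-identityʳ _))

  ιᵘ-unique : ∀ p {x} → natCast (ℚᵘ.↧ₙ p) * x ≈ intCast (ℚᵘ.↥ p) → ιᵘ p ≈ x
  ιᵘ-unique p@(mkℚᵘ num den-1) eq =
    *-cancelˡ-nonzero (natCast (suc den-1)) (charZero den-1) (trans (ιᵘ-numerator p) (sym eq))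

  ιᵘ-cong : ∀ {p q} → p ℚᵘ.≃ q → ιᵘ p ≈ ιᵘ q
  ιᵘ-cong {p@(mkℚᵘ a b)} {q@(mkℚᵘ e d)} (ℚᵘ.*≡* eq) = ιᵘ-unique p
    (*-cancelˡ-nonzero (natCast (suc d)) (charZero d) (begin
      natCast (suc d) * (natCast (suc b) * ιᵘ q)
        ≈⟨ solve 3 (λ d b x → d :* (b :* x) := d :* x :* b) refl _ _ _ ⟩
      natCast (suc d) * ιᵘ q * natCast (suc b)   ≈⟨ *-congʳ (ιᵘ-numerator q) ⟩
      intCast e * intCast (+ suc b)              ≈⟨ intCast-* e (+ suc b) ⟨
      intCast (e ℤ.* + suc b)                    ≡⟨ ≡.cong intCast eq ⟨
      intCast (a ℤ.* + suc d)                    ≈⟨ intCast-* a (+ suc d) ⟩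
      intCast a * natCast (suc d)                ≈⟨ *-comm _ _ ⟩
      natCast (suc d) * intCast a                ∎))

  ιᵘ-+ : ∀ p q → ιᵘ (p ℚᵘ.+ q) ≈ ιᵘ p + ιᵘ q
  ιᵘ-+ p@(mkℚᵘ a b) q@(mkℚᵘ e d) = ιᵘ-unique (p ℚᵘ.+ q) (begin
    natCast (suc b ℕ.* suc d) * (ιᵘ p + ιᵘ q)
      ≈⟨ *-congʳ (natCast-* (suc b) (suc d)) ⟩
    natCast (suc b) * natCast (suc d) * (ιᵘ p + ιᵘ q)
      ≈⟨ solve 4 (λ b d x y → b :* d :* (x :+ y) := b :* x :* d :+ d :* y :* b) refl _ _ _ _ ⟩
    natCast (suc b) * ιᵘ p * natCast (suc d) + natCast (suc d) * ιᵘ q * natCast (suc b)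
      ≈⟨ +-cong (*-congʳ (ιᵘ-numerator p)) (*-congʳ (ιᵘ-numerator q)) ⟩
    intCast a * intCast (+ suc d) + intCast e * intCast (+ suc b)
      ≈⟨ trans (intCast-+ (a ℤ.* + suc d) (e ℤ.* + suc b)) (+-cong (intCast-* a (+ suc d)) (intCast-* e (+ suc b))) ⟨
    intCast (a ℤ.* + suc d ℤ.+ e ℤ.* + suc b) ∎)

  ιᵘ-* : ∀ p q → ιᵘ (p ℚᵘ.* q) ≈ ιᵘ p * ιᵘ q
  ιᵘ-* p@(mkℚᵘ a b) q@(mkℚᵘ e d) = ιᵘ-unique (p ℚᵘ.* q) (begin
    natCast (suc b ℕ.* suc d) * (ιᵘ p * ιᵘ q)
      ≈⟨ *-congʳ (natCast-* (suc b) (suc d)) ⟩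
    natCast (suc b) * natCast (suc d) * (ιᵘ p * ιᵘ q)
      ≈⟨ solve 4 (λ b d x y → b :* d :* (x :* y) := b :* x :* (d :* y)) refl _ _ _ _ ⟩
    natCast (suc b) * ιᵘ p * (natCast (suc d) * ιᵘ q)
      ≈⟨ *-cong (ιᵘ-numerator p) (ιᵘ-numerator q) ⟩
    intCast a * intCast e
      ≈⟨ intCast-* a e ⟨
    intCast (a ℤ.* e) ∎)

  ι≈ιᵘ : ∀ p → ι p ≈ ιᵘ (ℚ.toℚᵘ p)
  ι≈ιᵘ (ℚ.mkℚ _ _ _) = refl

  ι-fromℚᵘ : ∀ p → ι (ℚ.fromℚᵘ p) ≈ ιᵘ p
  ι-fromℚᵘ p = trans (ι≈ιᵘ (ℚ.fromℚᵘ p)) (ιᵘ-cong (ℚₚ.toℚᵘ-fromℚᵘ p))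

  ι-+ : ∀ p q → ι (p ℚ.+ q) ≈ ι p + ι q
  ι-+ p q = begin
    ι (p ℚ.+ q)                       ≈⟨ ι≈ιᵘ (p ℚ.+ q) ⟩
    ιᵘ (ℚ.toℚᵘ (p ℚ.+ q))             ≈⟨ ιᵘ-cong (ℚₚ.toℚᵘ-homo-+ p q) ⟩
    ιᵘ (ℚ.toℚᵘ p ℚᵘ.+ ℚ.toℚᵘ q)       ≈⟨ ιᵘ-+ (ℚ.toℚᵘ p) (ℚ.toℚᵘ q) ⟩
    ιᵘ (ℚ.toℚᵘ p) + ιᵘ (ℚ.toℚᵘ q)     ≈⟨ +-cong (ι≈ιᵘ p) (ι≈ιᵘ q) ⟨
    ι p + ι q                         ∎

  ι-* : ∀ p q → ι (p ℚ.* q) ≈ ι p * ι q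
  ι-* p q = begin
    ι (p ℚ.* q)                       ≈⟨ ι≈ιᵘ (p ℚ.* q) ⟩
    ιᵘ (ℚ.toℚᵘ (p ℚ.* q))             ≈⟨ ιᵘ-cong (ℚₚ.toℚᵘ-homo-* p q) ⟩
    ιᵘ (ℚ.toℚᵘ p ℚᵘ.* ℚ.toℚᵘ q)       ≈⟨ ιᵘ-* (ℚ.toℚᵘ p) (ℚ.toℚᵘ q) ⟩
    ιᵘ (ℚ.toℚᵘ p) * ιᵘ (ℚ.toℚᵘ q)     ≈⟨ *-cong (ι≈ιᵘ p) (ι≈ιᵘ q) ⟨
    ι p * ι q                         ∎

  ι-natℚ : ∀ k → ι (natℚ k) ≈ natCast k
  ι-natℚ k = trans (ι-fromℚᵘ (mkℚᵘ (+ k) 0)) (ιᵘ-unique (mkℚᵘ (+ k) 0)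
    (solve 1 (λ x → (con (+ 1) :+ con (+ 0)) :* x := x) refl (natCast k)))

  ι-0 : ι ℚ.0ℚ ≈ 0#
  ι-0 = ι-natℚ 0

  ι-1 : ι ℚ.1ℚ ≈ 1#
  ι-1 = trans (ι-natℚ 1) (+-identityʳ 1#)

  ι-neg : ∀ p → ι (ℚ.- p) ≈ - ι p
  ι-neg p = begin
    ι (ℚ.- p)                 ≈⟨ solve 2 (λ x y → x := y :+ x :- y) refl (ι (ℚ.- p)) (ι p) ⟩
    ι p + ι (ℚ.- p) - ι p     ≈⟨ +-congʳ (ι-+ p (ℚ.- p)) ⟨
    ι (p ℚ.+ ℚ.- p) - ι p     ≡⟨ ≡.cong (λ q → ι q - ι p) (ℚₚ.+-inverseʳ p) ⟩
    ι ℚ.0ℚ - ι p              ≈⟨ trans (+-congʳ ι-0) (+-identityˡ _) ⟩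
    - ι p                     ∎

  ι-recip : ∀ k .{{_ : ℕ.NonZero k}} → natCast k * ι (recip k) ≈ 1#
  ι-recip (suc k) = begin
    natCast (suc k) * ι (recip (suc k))   ≈⟨ *-congˡ (ι-fromℚᵘ (mkℚᵘ (+ 1) k)) ⟩
    natCast (suc k) * ιᵘ (mkℚᵘ (+ 1) k)   ≈⟨ ιᵘ-numerator (mkℚᵘ (+ 1) k) ⟩
    1# + 0#                               ≈⟨ +-identityʳ 1# ⟩
    1#                                    ∎

  ι-sgn : ∀ e → ι (sgn e) ≈ pow (- 1#) e
  ι-sgn zero    = ι-1
  ι-sgn (suc e) = trans (ι-neg (sgn e)) (trans (-‿cong (ι-sgn e))
    (solve 1 (λ s → :- s := :- con (+ 1) :* s) refl _))

  ι-sumℚ-upTo : ∀ (h : ℕ → ℚ) k → ι (sumℚ (map h (upTo k))) ≈ sum< k (ι ∘ h)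
  ι-sumℚ-upTo h k = trans (reflexive (≡.cong (ι ∘ sumℚ) (map-upTo h k))) (go h k)
    where
    go : ∀ h k → ι (sumℚ (applyUpTo h k)) ≈ sum< k (ι ∘ h)
    go h zero    = ι-0
    go h (suc k) = trans (ι-+ (h 0) _) (+-congˡ (go (h ∘ suc) k))

  ι-^ : ∀ n j → ι (natℚ (n ℕ.^ j)) ≈ pow (natCast n) j
  ι-^ n j = trans (ι-natℚ (n ℕ.^ j)) (go j)
    where
    go : ∀ j → natCast (n ℕ.^ j) ≈ pow (natCast n) j
    go zero    = +-identityʳ 1#
    go (suc j) = trans (natCast-* n (n ℕ.^ j)) (*-congˡ (go j))

-- Degenerate Bernoulli numbers at 1/n as the coefficients of 1/P

module Bernoulli {c ℓ : Level} (K : Field c ℓ) (charZero : FieldOps.CharZero K) (N : ℕ) where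
  open Field K hiding (zero)
  open FieldOps K
  open Casts K
  open Series K
  open Symmetric K
  open Binomial K
  open Embedding K charZero
  open import Relation.Binary.Reasoning.Setoid setoid

  private
    n = natCast (suc N)
    λ' = recip (suc N)
    ratio : ℕ → ℚ
    ratio r = ℚ.1ℚ ℚ.- natℚ r ℚ.* λ'

  b : ℕ → Carrier
  b k = ι (headℚ (bList λ' k))

  -- `bList` keeps the newest coefficient in front, so zipping it with an increasing list of
  -- coefficients is already a Cauchy product.
  bList-convolution : ∀ (h : ℕ → ℚ) k →
    ι (sumℚ (zipWith ℚ._*_ (applyUpTo h (suc k)) (bList λ' k))) ≈ ((ι ∘ h) ⊛ b) k
  bList-convolution h zero    = trans (ι-+ (h 0 ℚ.* ℚ.1ℚ) ℚ.0ℚ)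
    (trans (+-cong (ι-* (h 0) ℚ.1ℚ) ι-0) (+-identityʳ _))
  bList-convolution h (suc k) = trans (ι-+ (h 0 ℚ.* headℚ (bList λ' (suc k))) _)
    (+-cong (ι-* (h 0) (headℚ (bList λ' (suc k)))) (bList-convolution (h ∘ suc) k))

  -- The difference `n - i` is formed in `K`, so `i` needs no bound: past `n` the binomials vanish.
  falling : ∀ i → natCast (suc i) * binom (suc N) (suc i) ≈ (n - natCast i) * binom (suc N) i
  falling zero    = trans (absorption N 0)
    (solve 1 (λ n → n :* (con (+ 1) :+ con (+ 0)) := (n :- con (+ 0)) :* (con (+ 1) :+ con (+ 0))) refl n)
  falling (suc i) = begin
    natCast (suc (suc i)) * binom (suc N) (suc (suc i))   ≈⟨ absorption N (suc i) ⟩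
    n * binom N (suc i)
      ≈⟨ solve 3 (λ n p q → n :* q := n :* (p :+ q) :- n :* p) refl n (binom N i) _ ⟩
    n * (binom N i + binom N (suc i)) - n * binom N i
      ≈⟨ +-cong (*-congˡ (pascal N i)) (-‿cong (absorption N i)) ⟨
    n * binom (suc N) (suc i) - natCast (suc i) * binom (suc N) (suc i)
      ≈⟨ solve 3 (λ n k p → n :* p :- k :* p := (n :- k) :* p) refl n (natCast (suc i)) _ ⟩
    (n - natCast (suc i)) * binom (suc N) (suc i) ∎

  ι-ratio : ∀ r → n * ι (ratio r) ≈ n - natCast r
  ι-ratio r = begin
    n * ι (ratio r)
      ≈⟨ *-congˡ (trans (ι-+ ℚ.1ℚ (ℚ.- (natℚ r ℚ.* λ'))) (+-cong ι-1 (trans (ι-neg (natℚ r ℚ.* λ'))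
           (-‿cong (trans (ι-* (natℚ r) λ') (*-congʳ (ι-natℚ r))))))) ⟩
    n * (1# - natCast r * ι λ')
      ≈⟨ solve 3 (λ n r x → n :* (con (+ 1) :- r :* x) := n :- r :* (n :* x)) refl n (natCast r) (ι λ') ⟩
    n - natCast r * (n * ι λ')
      ≈⟨ +-congˡ (-‿cong (trans (*-congˡ (ι-recip (suc N))) (*-identityʳ _))) ⟩
    n - natCast r ∎

  prodℚ-∷ʳ : ∀ (h : ℕ → ℚ) i → prodℚ (applyUpTo h (suc i)) ≡ prodℚ (applyUpTo h i) ℚ.* h i
  prodℚ-∷ʳ h zero    = ℚₚ.*-comm (h 0) ℚ.1ℚ
  prodℚ-∷ʳ h (suc i) = ≡.trans (≡.cong (h 0 ℚ.*_) (prodℚ-∷ʳ (h ∘ suc) i))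
    (≡.sym (ℚₚ.*-assoc (h 0) (prodℚ (applyUpTo (h ∘ suc) i)) (h (suc i))))

  ι-falling : ∀ i → pow n i * ι (prodℚ (applyUpTo ratio i)) ≈ natCast (i !) * binom (suc N) i
  ι-falling zero    = trans (*-congˡ ι-1)
    (solve 0 (con (+ 1) :* con (+ 1) := (con (+ 1) :+ con (+ 0)) :* (con (+ 1) :+ con (+ 0))) refl)
  ι-falling (suc i) = begin
    n * pow n i * ι (prodℚ (applyUpTo ratio (suc i)))
      ≈⟨ *-congˡ (trans (reflexive (≡.cong ι (prodℚ-∷ʳ ratio i))) (ι-* (prodℚ (applyUpTo ratio i)) (ratio i))) ⟩
    n * pow n i * (ι (prodℚ (applyUpTo ratio i)) * ι (ratio i))
      ≈⟨ solve 4 (λ n p x y → n :* p :* (x :* y) := p :* x :* (n :* y)) refl n _ _ _ ⟩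
    pow n i * ι (prodℚ (applyUpTo ratio i)) * (n * ι (ratio i))
      ≈⟨ *-cong (ι-falling i) (ι-ratio i) ⟩
    natCast (i !) * binom (suc N) i * (n - natCast i)
      ≈⟨ solve 3 (λ f b x → f :* b :* x := f :* (x :* b)) refl _ _ _ ⟩
    natCast (i !) * ((n - natCast i) * binom (suc N) i)
      ≈⟨ *-congˡ (falling i) ⟨
    natCast (i !) * (natCast (suc i) * binom (suc N) (suc i))
      ≈⟨ solve 3 (λ f k b → f :* (k :* b) := k :* f :* b) refl _ _ _ ⟩
    natCast (suc i) * natCast (i !) * binom (suc N) (suc i)
      ≈⟨ *-congʳ (natCast-* (suc i) (i !)) ⟨
    natCast (suc i !) * binom (suc N) (suc i) ∎

  -- For `λ = 1/n` each factor `1 - r λ` is `(n - r)/n`. In the variable `T = t/n` the series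
  -- `(1 + λ t)^(1/λ)` is thus the polynomial `(1 + T)^n`.
  ι-cCoeff : ∀ i → pow n i * ι (cCoeff λ' i) ≈ binom (suc N) i
  ι-cCoeff i = begin
    pow n i * ι (cCoeff λ' i)
      ≈⟨ *-congˡ (trans (ι-* (prodℚ (map ratio (upTo i))) (recip (i !))) (*-congʳ (reflexive (≡.cong (ι ∘ prodℚ) (map-upTo ratio i))))) ⟩
    pow n i * (ι (prodℚ (applyUpTo ratio i)) * ι (recip (i !)))
      ≈⟨ trans (sym (*-assoc _ _ _)) (*-congʳ (ι-falling i)) ⟩
    natCast (i !) * binom (suc N) i * ι (recip (i !))
      ≈⟨ solve 3 (λ f b x → f :* b :* x := f :* x :* b) refl _ _ _ ⟩
    natCast (i !) * ι (recip (i !)) * binom (suc N) i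
      ≈⟨ trans (*-congʳ (ι-recip (i !) {{ℕₚ._!≢0 i}})) (*-identityˡ _) ⟩
    binom (suc N) i ∎

  d⊛b : (ι ∘ dCoeff λ') ⊛ b ≋ δ
  d⊛b k = go k
    where
    d₀≈1 : ι (dCoeff λ' 0) ≈ 1#
    d₀≈1 = *-cancelˡ-nonzero n (charZero N) (begin
      n * ι (dCoeff λ' 0)          ≈⟨ *-congʳ (*-identityʳ n) ⟨
      n * 1# * ι (cCoeff λ' 1)     ≈⟨ ι-cCoeff 1 ⟩
      binom (suc N) 1              ≈⟨ trans (binom-one (suc N)) (sym (*-identityʳ n)) ⟩
      n * 1#                       ∎)
    go : ∀ k → ((ι ∘ dCoeff λ') ⊛ b) k ≈ δ k
    go zero    = trans (*-cong d₀≈1 ι-1) (*-identityˡ 1#)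
    go (suc k) = begin
      ι (dCoeff λ' 0) * b (suc k) + rest
        ≈⟨ +-congʳ (trans (*-congʳ d₀≈1) (*-identityˡ _)) ⟩
      b (suc k) + rest
        ≈⟨ +-congʳ (trans (ι-neg (sumℚ (zipWith ℚ._*_ (map (dCoeff λ' ∘ suc) (upTo (suc k))) (bList λ' k)))) (-‿cong (trans
             (reflexive (≡.cong (λ xs → ι (sumℚ (zipWith ℚ._*_ xs (bList λ' k)))) (map-upTo (dCoeff λ' ∘ suc) (suc k))))
             (bList-convolution (dCoeff λ' ∘ suc) k)))) ⟩
      - rest + rest   ≈⟨ -‿inverseˡ rest ⟩
      0# ∎
      where rest = ((ι ∘ dCoeff λ' ∘ suc) ⊛ b) k

  -- The substitution `T ↦ a T` respects products.
  ⊛-geometric : ∀ a c d → (λ i → pow a i * c i) ⊛ (λ i → pow a i * d i) ≋ (λ k → pow a k * (c ⊛ d) k)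
  ⊛-geometric a c d zero    = solve 2 (λ c d → con (+ 1) :* c :* (con (+ 1) :* d) := con (+ 1) :* (c :* d)) refl _ _
  ⊛-geometric a c d (suc k) = begin
    1# * c 0 * (pow a (suc k) * d (suc k)) + ((λ i → a * pow a i * c (suc i)) ⊛ (λ i → pow a i * d i)) k
      ≈⟨ +-congˡ (trans (⊛-cong {d = λ i → pow a i * d i} (λ i → *-assoc a (pow a i) (c (suc i))) (λ _ → refl) k)
           (trans (⊛-scaleˡ a (λ i → pow a i * c (suc i)) _ k) (*-congˡ (⊛-geometric a (c ∘ suc) d k)))) ⟩
    1# * c 0 * (a * pow a k * d (suc k)) + a * (pow a k * ((c ∘ suc) ⊛ d) k)
      ≈⟨ solve 5 (λ a p c d r → con (+ 1) :* c :* (a :* p :* d) :+ a :* (p :* r) := a :* p :* (c :* d :+ r)) refl a (pow a k) _ _ _ ⟩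
    pow a (suc k) * (c ⊛ d) (suc k) ∎

  -- The number `n^j β_j(1/n) / j!`, with the power of `n` coming from `t = n T`.
  scaled : ℕ → Carrier
  scaled j = pow n j * b j

  ι-β : ∀ j → ι (natℚ (suc N ℕ.^ j)) * ι (β j λ') ≈ natCast (j !) * scaled j
  ι-β j = trans (*-cong (ι-^ (suc N) j) (trans (ι-* (natℚ (j !)) (headℚ (bList λ' j))) (*-congʳ (ι-natℚ (j !)))))
    (solve 3 (λ p f x → p :* (f :* x) := f :* (p :* x)) refl _ _ _)

  module _ {A : Set} (f : A → Carrier) (L : List A)
    (elem-f : ∀ k → n * elem f L k ≈ binom (suc N) (suc k)) where

    elem⊛scaled : elem f L ⊛ scaled ≋ δ
    elem⊛scaled k = begin
      (elem f L ⊛ scaled) k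
        ≈⟨ ⊛-cong {d = scaled} d-elem (λ _ → refl) k ⟩
      ((λ i → pow n i * ι (dCoeff λ' i)) ⊛ scaled) k
        ≈⟨ ⊛-geometric n (ι ∘ dCoeff λ') b k ⟩
      pow n k * ((ι ∘ dCoeff λ') ⊛ b) k
        ≈⟨ *-congˡ (d⊛b k) ⟩
      pow n k * δ k
        ≈⟨ pow-δ k ⟩
      δ k ∎
      where
      d-elem : ∀ i → elem f L i ≈ pow n i * ι (dCoeff λ' i)
      d-elem i = *-cancelˡ-nonzero n (charZero N) (trans (elem-f i) (trans (sym (ι-cCoeff (suc i))) (*-assoc _ _ _)))
      pow-δ : ∀ k → pow n k * δ k ≈ δ k
      pow-δ zero    = *-identityˡ 1#
      pow-δ (suc k) = zeroʳ _

-- From the nested sums to symmetric functions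

module Zetas {c ℓ : Level} (K : Field c ℓ) (f : ℕ → Field.Carrier K) where
  open Field K hiding (zero)
  open FieldOps K
  open Casts K
  open Symmetric K
  open Binomial K
  open import Relation.Binary.Reasoning.Setoid setoid

  private
    f² : ℕ → Carrier
    f² i = f i * f i

  monomial : List ℕ → List ℕ → Carrier
  monomial s is = prodK (zipWith (λ i sk → pow (f i) sk) is s)

  -- The sum `Zeta` over an arbitrary list of indices, which makes induction on that list possible.
  zetaOver : List ℕ → List ℕ → Carrier
  zetaOver s L = sumK (map (monomial s) (choose (length s) L))

  zetaOver-∷ : ∀ t s x L → zetaOver (t ∷ s) (x ∷ L) ≈ pow (f x) t * zetaOver s L + zetaOver (t ∷ s) L
  zetaOver-∷ t s x L = go (choose (length s) L)
    where
    go : ∀ Is → sumK (map (monomial (t ∷ s)) (map (x ∷_) Is ++ choose (suc (length s)) L))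
      ≈ pow (f x) t * sumK (map (monomial s) Is) + zetaOver (t ∷ s) L
    go []        = sym (trans (+-congʳ (zeroʳ _)) (+-identityˡ _))
    go (is ∷ Is) = trans (+-congˡ (go Is))
      (solve 4 (λ a p q r → a :* p :+ (a :* q :+ r) := a :* (p :+ q) :+ r) refl _ _ _ _)

  zetaOver-twos : ∀ m L → zetaOver (replicate m 2) L ≈ elem f² L m
  zetaOver-twos zero    L       = trans (+-identityʳ 1#) (sym (elem-0 f² L))
  zetaOver-twos (suc m) []      = refl
  zetaOver-twos (suc m) (x ∷ L) = begin
    zetaOver (2 ∷ replicate m 2) (x ∷ L)
      ≈⟨ zetaOver-∷ 2 (replicate m 2) x L ⟩
    pow (f x) 2 * zetaOver (replicate m 2) L + zetaOver (replicate (suc m) 2) L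
      ≈⟨ +-cong (*-cong (*-congˡ (*-identityʳ _)) (zetaOver-twos m L)) (zetaOver-twos (suc m) L) ⟩
    f² x * elem f² L m + elem f² L (suc m)
      ≈⟨ +-comm _ _ ⟩
    elem f² (x ∷ L) (suc m) ∎

  -- A position for `A` together with an increasing tuple amounts to one marked index and `m`
  -- unordered others, since the other exponents all agree. The depth is `suc m`.
  zetaOver-twosWith : ∀ A m L →
    sum< (suc m) (λ j → zetaOver (twosWith (suc m) (suc j) A) L) ≈ marked (λ i → pow (f i) A) f² L m
  zetaOver-twosWith A m []      = trans
    -- The case split on the position lets the length of the exponent list reduce to a successor, so
    -- that `choose` returns no tuples.
    (sum<-cong (suc m) {g = λ j → zetaOver (twosWith (suc m) (suc j) A) []} {h = λ _ → 0# * 0#} (λ { zero _ → sym (zeroˡ _) ; (suc _) _ → sym (zeroˡ _) }))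
    (trans (sum<-scale 0# (suc m) (λ _ → 0#)) (zeroˡ _))
  zetaOver-twosWith A m (x ∷ L) = begin
    -- The head `x` is the smallest index, so if it occurs it takes the first exponent: `A` in the
    -- first summand, 2 in all others.
    zetaOver (A ∷ replicate m 2) (x ∷ L) + sum< m (λ j → zetaOver (2 ∷ twosWith m (suc j) A) (x ∷ L))
      ≈⟨ +-cong (trans (zetaOver-∷ A (replicate m 2) x L) (+-congʳ (*-congˡ (zetaOver-twos m L))))
           (trans (sum<-cong m (λ j _ → zetaOver-∷ 2 (twosWith m (suc j) A) x L))
             (trans (sum<-+ m _ _) (+-congʳ (sum<-scale (pow (f x) 2) m _)))) ⟩
    pow (f x) A * elem f² L m + zetaOver (A ∷ replicate m 2) L
      + (pow (f x) 2 * sum< m (λ j → zetaOver (twosWith m (suc j) A) L)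
         + sum< m (λ j → zetaOver (twosWith (suc m) (suc (suc j)) A) L))
      ≈⟨ solve 4 (λ p q r s → p :+ q :+ (r :+ s) := p :+ (r :+ (q :+ s))) refl _ _ _ _ ⟩
    pow (f x) A * elem f² L m + (pow (f x) 2 * sum< m (λ j → zetaOver (twosWith m (suc j) A) L)
      + sum< (suc m) (λ j → zetaOver (twosWith (suc m) (suc j) A) L))
      ≈⟨ +-congˡ (trans (+-congˡ (zetaOver-twosWith A m L)) (rest m)) ⟩
    marked (λ i → pow (f i) A) f² (x ∷ L) m ∎
    where
    M = marked (λ i → pow (f i) A) f² L
    rest : ∀ m → pow (f x) 2 * sum< m (λ j → zetaOver (twosWith m (suc j) A) L) + M m
      ≈ Series.lin K (f² x) M m
    rest zero    = trans (+-congʳ (zeroʳ _)) (+-identityˡ _)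
    rest (suc m) = trans (+-congʳ (*-cong (*-congˡ (*-identityʳ _)) (zetaOver-twosWith A m L))) (+-comm _ _)

-- The nodes attached to a primitive root of unity

module PrimitiveRoot {c ℓ : Level} (K : Field c ℓ) (N : ℕ) (ζ : Field.Carrier K)
  (isPrimitive : FieldOps.IsPrimitiveRoot K ζ (suc N)) where
  open Field K hiding (zero)
  open FieldOps K
  open Casts K
  open Symmetric K
  open Binomial K
  open Roots K
  open import Relation.Binary.Reasoning.Setoid setoid

  pow-cong : ∀ {x y} k → x ≈ y → pow x k ≈ pow y k
  pow-cong zero    x≈y = refl
  pow-cong (suc k) x≈y = *-cong x≈y (pow-cong k x≈y)

  pow-+ : ∀ x i j → pow x (i ℕ.+ j) ≈ pow x i * pow x j
  pow-+ x zero    j = sym (*-identityˡ _)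
  pow-+ x (suc i) j = trans (*-congˡ (pow-+ x i j)) (sym (*-assoc _ _ _))

  pow-distrib-* : ∀ x y k → pow (x * y) k ≈ pow x k * pow y k
  pow-distrib-* x y zero    = sym (*-identityˡ _)
  pow-distrib-* x y (suc k) = trans (*-congˡ (pow-distrib-* x y k))
    (solve 4 (λ x y p q → x :* y :* (p :* q) := x :* p :* (y :* q)) refl _ _ _ _)

  pow-one : ∀ k → pow 1# k ≈ 1#
  pow-one zero    = refl
  pow-one (suc k) = trans (*-identityˡ _) (pow-one k)

  pow-swap : ∀ x i k → pow (pow x i) k ≈ pow (pow x k) i
  pow-swap x i zero    = sym (pow-one i)
  pow-swap x i (suc k) = trans (*-congˡ (pow-swap x i k)) (sym (pow-distrib-* x (pow x k) i))

  pow-root : ∀ i y → pow (pow ζ i * y) (suc N) ≈ pow y (suc N)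
  pow-root i y = begin
    pow (pow ζ i * y) (suc N)                ≈⟨ pow-distrib-* (pow ζ i) y (suc N) ⟩
    pow (pow ζ i) (suc N) * pow y (suc N)
      ≈⟨ *-congʳ (trans (pow-swap ζ i (suc N)) (trans (pow-cong i (proj₁ isPrimitive)) (pow-one i))) ⟩
    1# * pow y (suc N)                       ≈⟨ *-identityˡ _ ⟩
    pow y (suc N)                            ∎

  node : ℕ → Carrier
  node i = (1# - pow ζ i) ⁻¹

  indices : List ℕ
  indices = applyUpTo suc N

  node-inverse : ∀ {i} → i ℕ.< N → (1# - pow ζ (suc i)) * node (suc i) ≈ 1#
  node-inverse {i} i<N = ⁻¹-inverse _ (λ eq → proj₂ isPrimitive (suc i) (ℕ.s≤s ℕ.z≤n) (ℕ.s≤s i<N)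
    (trans (solve 1 (λ z → z := con (+ 1) :- (con (+ 1) :- z)) refl _)
      (trans (+-congˡ (-‿cong eq)) (solve 0 (con (+ 1) :- con (+ 0) := con (+ 1)) refl))))

  -- Equal nodes give `ζ^(i+1) = ζ^(j+1)`. Multiplying by `ζ^(n-(j+1))` then yields a power equal to
  -- 1 whose exponent lies strictly between 0 and `n`.
  node-distinct : ∀ {i j} → i ℕ.< j → j ℕ.< N → ¬ (node (suc i) ≈ node (suc j))
  node-distinct {i} {j} i<j j<N eq = proj₂ isPrimitive (suc i ℕ.+ (N ℕ.∸ j)) (ℕ.s≤s ℕ.z≤n) bound (begin
    pow ζ (suc i ℕ.+ (N ℕ.∸ j))             ≈⟨ pow-+ ζ (suc i) (N ℕ.∸ j) ⟩
    pow ζ (suc i) * pow ζ (N ℕ.∸ j)         ≈⟨ *-congʳ ζⁱ≈ζʲ ⟩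
    pow ζ (suc j) * pow ζ (N ℕ.∸ j)         ≈⟨ pow-+ ζ (suc j) (N ℕ.∸ j) ⟨
    pow ζ (suc j ℕ.+ (N ℕ.∸ j))             ≡⟨ ≡.cong (pow ζ ∘ suc) (ℕₚ.m+[n∸m]≡n (ℕₚ.<⇒≤ j<N)) ⟩
    pow ζ (suc N)                           ≈⟨ proj₁ isPrimitive ⟩
    1#                                      ∎)
    where
    bound : suc i ℕ.+ (N ℕ.∸ j) ℕ.< suc N
    bound = ℕ.s≤s (≡.subst (i ℕ.+ (N ℕ.∸ j) ℕ.<_) (ℕₚ.m+[n∸m]≡n (ℕₚ.<⇒≤ j<N)) (ℕₚ.+-monoˡ-< (N ℕ.∸ j) i<j))
    p = 1# - pow ζ (suc i)
    q = 1# - pow ζ (suc j)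
    p≈q : p ≈ q
    p≈q = begin
      p                        ≈⟨ trans (*-congˡ (node-inverse j<N)) (*-identityʳ p) ⟨
      p * (q * node (suc j))   ≈⟨ *-congˡ (*-congˡ eq) ⟨
      p * (q * node (suc i))   ≈⟨ solve 3 (λ p q x → p :* (q :* x) := q :* (p :* x)) refl p q _ ⟩
      q * (p * node (suc i))   ≈⟨ trans (*-congˡ (node-inverse (ℕₚ.<-trans i<j j<N))) (*-identityʳ q) ⟩
      q                        ∎
    ζⁱ≈ζʲ : pow ζ (suc i) ≈ pow ζ (suc j)
    ζⁱ≈ζʲ = trans (solve 1 (λ z → z := con (+ 1) :- (con (+ 1) :- z)) refl _)
      (trans (+-congˡ (-‿cong p≈q)) (solve 1 (λ z → con (+ 1) :- (con (+ 1) :- z) := z) refl _))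

  private
    length-indices : length indices ≡ N
    length-indices = length-applyUpTo suc N

    fromNodes : ∀ (f : ℕ → Carrier) →
      (∀ {i j} → i ℕ.< j → j ℕ.< N → ¬ (f (suc i) ≈ f (suc j))) →
      (∀ {i} → i ℕ.< N → pow (1# - f (suc i)) (suc N) ≈ pow (- f (suc i)) (suc N)) →
      ∀ k → natCast (suc N) * elem f indices k ≈ binom (suc N) (suc k)
    fromNodes f distinct roots = ≡.subst
      (λ M → All (λ i → pow (1# - f i) (suc M) ≈ pow (- f i) (suc M)) indices →
             ∀ k → natCast (suc M) * elem f indices k ≈ binom (suc M) (suc k))
      length-indices (elem-nodes f indices (AllPairsₚ.applyUpTo⁺₁ suc N distinct))
      (Allₚ.applyUpTo⁺₁ suc N roots)

  -- From `(1 - ζ^i) x = 1` follows `1 - x = ζ^i (- x)`, and the root of unity disappears in the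
  -- `n`-th power.
  elem-node : ∀ k → natCast (suc N) * elem node indices k ≈ binom (suc N) (suc k)
  elem-node = fromNodes node node-distinct (λ {i} i<N → trans
    (pow-cong (suc N) (trans (+-congʳ (sym (node-inverse i<N)))
      (solve 2 (λ z x → (con (+ 1) :- z) :* x :- x := z :* :- x) refl (pow ζ (suc i)) (node (suc i)))))
    (pow-root (suc i) (- node (suc i))))

  -- The same relation in the form `- (1 - x) = ζ^i x` verifies the power equation for `1 - x`
  -- directly.
  elem-conode : ∀ k → natCast (suc N) * elem (λ i → 1# - node i) indices k ≈ binom (suc N) (suc k)
  elem-conode = fromNodes (λ i → 1# - node i)
    (λ {i} {j} i<j j<N eq → node-distinct i<j j<N
      (trans (solve 1 (λ x → x := con (+ 1) :- (con (+ 1) :- x)) refl _)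
        (trans (+-congˡ (-‿cong eq)) (solve 1 (λ x → con (+ 1) :- (con (+ 1) :- x) := x) refl _))))
    (λ {i} i<N → trans
      (pow-cong (suc N) (solve 1 (λ x → con (+ 1) :- (con (+ 1) :- x) := x) refl (node (suc i))))
      (trans (sym (pow-root (suc i) (node (suc i)))) (pow-cong (suc N) (sym
        (trans (-‿cong (+-congʳ (sym (node-inverse i<N))))
          (solve 2 (λ z x → :- ((con (+ 1) :- z) :* x :- x) := z :* x) refl (pow ζ (suc i)) (node (suc i))))))))

-- Reduction of the exponent and comparison with the closed forms

module Evaluation {c ℓ : Level} (K : Field c ℓ) (charZero : FieldOps.CharZero K)
  (N : ℕ) (ζ : Field.Carrier K) (isPrimitive : FieldOps.IsPrimitiveRoot K ζ (suc N)) where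
  open Field K hiding (zero)
  open FieldOps K
  open Casts K
  open Symmetric K
  open Binomial K
  open Embedding K charZero
  open Bernoulli K charZero N
  open PrimitiveRoot K N ζ isPrimitive
  open Zetas K node
  open import Relation.Binary.Reasoning.Setoid setoid
  private
    module X = Nodes K charZero node indices N (length-applyUpTo suc N) elem-node
    module W = Nodes K charZero (λ i → 1# - node i) indices N (length-applyUpTo suc N) elem-conode

    n = natCast (suc N)
    λ' = recip (suc N)

    x² : ℕ → Carrier
    x² i = node i * node i

    p : ℕ → Carrier
    p s = sumOver (λ i → pow (node i) s) indices

    e : ℕ → Carrier
    e = elem x² indices

    D : ℕ → ℕ → Carrier
    D s = marked (λ i → pow (node i) s) x² indices

  LHS-marked : ∀ m A → LHS (suc N) (suc m) ζ A ≈ D A m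
  LHS-marked m A = begin
    sumK (map term (map suc (upTo (suc m))))
      ≡⟨ ≡.cong sumK (≡.trans (≡.sym (map-∘ (upTo (suc m)))) (map-upTo (term ∘ suc) (suc m))) ⟩
    sum< (suc m) (term ∘ suc)
      ≡⟨ ≡.cong (λ L → sum< (suc m) (λ j → zetaOver (twosWith (suc m) (suc j) A) L)) (map-upTo suc N) ⟩
    sum< (suc m) (λ j → zetaOver (twosWith (suc m) (suc j) A) indices)
      ≈⟨ zetaOver-twosWith A m indices ⟩
    D A m ∎
    where
    term : ℕ → Carrier
    term j = Zeta (suc N) ζ (twosWith (suc m) j A)

  D-step : ∀ s m → D (suc (suc s)) m ≈ p s * e (suc m) - D s (suc m)
  D-step s m = begin
    D (suc (suc s)) m
      ≈⟨ marked-cong (λ i → solve 2 (λ x q → x :* (x :* q) := q :* (x :* x)) refl (node i) (pow (node i) s))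
           (λ _ → refl) indices m ⟩
    marked (λ i → pow (node i) s * x² i) x² indices m
      ≈⟨ solve 2 (λ a b → b := a :+ b :- a) refl (D s (suc m)) _ ⟩
    D s (suc m) + marked (λ i → pow (node i) s * x² i) x² indices m - D s (suc m)
      ≈⟨ +-congʳ (sum*elem-suc (λ i → pow (node i) s) x² indices m) ⟨
    p s * e (suc m) - D s (suc m) ∎

  -- Each use of `D-step` lowers the exponent by 2, raises the index by 1 and flips the sign.
  -- Writing the exponent as `a * 2 + A₀` makes two successors appear by computation.
  unroll : ∀ A₀ a m → D (a ℕ.* 2 ℕ.+ A₀) m ≈
    sum< a (λ k → pow (- 1#) k * (p ((a ℕ.∸ suc k) ℕ.* 2 ℕ.+ A₀) * e (suc m ℕ.+ k)))
      + pow (- 1#) a * D A₀ (m ℕ.+ a)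
  unroll A₀ zero    m = trans (reflexive (≡.cong (D A₀) (≡.sym (ℕₚ.+-identityʳ m))))
    (solve 1 (λ d → d := con (+ 0) :+ con (+ 1) :* d) refl _)
  unroll A₀ (suc a) m = begin
    D (suc (suc (a ℕ.* 2 ℕ.+ A₀))) m
      ≈⟨ D-step (a ℕ.* 2 ℕ.+ A₀) m ⟩
    p (a ℕ.* 2 ℕ.+ A₀) * e (suc m) - D (a ℕ.* 2 ℕ.+ A₀) (suc m)
      ≈⟨ +-cong (*-congˡ (reflexive (≡.cong (e ∘ suc) (≡.sym (ℕₚ.+-identityʳ m))))) (-‿cong (unroll A₀ a (suc m))) ⟩
    first - (sum< a (λ k → pow (- 1#) k * (p ((a ℕ.∸ suc k) ℕ.* 2 ℕ.+ A₀) * e (suc (suc m) ℕ.+ k)))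
      + pow (- 1#) a * D A₀ (suc m ℕ.+ a))
      ≈⟨ solve 4 (λ f s q d → f :- (s :+ q :* d)
           := con (+ 1) :* f :+ :- con (+ 1) :* s :+ :- con (+ 1) :* q :* d) refl first _ (pow (- 1#) a) _ ⟩
    1# * first + - 1# * sum< a (λ k → pow (- 1#) k * (p ((a ℕ.∸ suc k) ℕ.* 2 ℕ.+ A₀) * e (suc (suc m) ℕ.+ k)))
      + - 1# * pow (- 1#) a * D A₀ (suc m ℕ.+ a)
      ≈⟨ +-cong (+-congˡ (trans (sym (sum<-scale (- 1#) a _)) (sum<-cong a (λ k _ →
           trans (sym (*-assoc _ _ _)) (*-congˡ (*-congˡ (reflexive (≡.cong (e ∘ suc) (≡.sym (ℕₚ.+-suc m k))))))))))
           (*-congˡ (reflexive (≡.cong (D A₀) (≡.sym (ℕₚ.+-suc m a))))) ⟩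
    sum< (suc a) (λ k → pow (- 1#) k * (p ((suc a ℕ.∸ suc k) ℕ.* 2 ℕ.+ A₀) * e (suc m ℕ.+ k)))
      + pow (- 1#) (suc a) * D A₀ (m ℕ.+ suc a) ∎
    where first = p (a ℕ.* 2 ℕ.+ A₀) * e (suc m ℕ.+ 0)

  -- Multiplying `elem-square` by `M + 1` lets both binomials absorb their lower index, since the
  -- factor 2 turns `M + 1` into `2M + 2`. This is the source of the brackets and of the
  -- denominators `n (m + k + 1)`.
  elem-closed : ∀ M → n * natCast (suc M) * e M ≈ binom N M + pow (- 1#) M * binom N (suc (M ℕ.+ M))
  elem-closed M = *-cancelˡ-nonzero n (charZero N) (begin
    n * (n * M′ * e M)
      ≈⟨ solve 3 (λ n m e → n :* (n :* m :* e) := m :* (n :* n :* e)) refl n M′ (e M) ⟩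
    M′ * (n * n * e M)
      ≈⟨ *-congˡ (X.elem-square M) ⟩
    M′ * (B₁ + (1# + 1#) * (s * B₂))
      ≈⟨ solve 4 (λ m b s c → (con (+ 1) :+ m) :* (b :+ (con (+ 1) :+ con (+ 1)) :* (s :* c))
           := (con (+ 1) :+ m) :* b :+ s :* ((con (+ 1) :+ (con (+ 1) :+ (m :+ m))) :* c)) refl (natCast M) B₁ s B₂ ⟩
    M′ * B₁ + s * ((1# + (1# + (natCast M + natCast M))) * B₂)
      ≈⟨ +-cong (absorption N M) (*-congˡ (trans
           (*-congʳ (+-congˡ (+-congˡ (sym (natCast-+ M M))))) (absorption N (suc (M ℕ.+ M))))) ⟩
    n * binom N M + s * (n * binom N (suc (M ℕ.+ M)))
      ≈⟨ solve 4 (λ n p s q → n :* p :+ s :* (n :* q) := n :* (p :+ s :* q)) refl n _ s _ ⟩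
    n * (binom N M + s * binom N (suc (M ℕ.+ M))) ∎)
    where
    M′ = natCast (suc M)
    s = pow (- 1#) M
    B₁ = binom (suc N) (suc M)
    B₂ = binom (suc N) (suc (suc (M ℕ.+ M)))

  -- The degenerate Bernoulli numbers come from the nodes 1 - x, and Σ_i C(r,i) (x - 1)^i = x^r.
  bernoulli-powerSum : ∀ r → sum< (suc r) (λ i → binom r i * scaled (suc i)) ≈ - p (suc r)
  bernoulli-powerSum r = begin
    sum< (suc r) (λ i → binom r i * scaled (suc i))
      ≈⟨ binomialTransform-sum r (scaled ∘ suc) ⟨
    binomialTransform r (scaled ∘ suc)
      ≈⟨ binomialTransform-cong r (W.reciprocal-suc scaled (elem⊛scaled (λ i → 1# - node i) indices elem-conode)) ⟩
    binomialTransform r (λ j → sumOver (λ i → (1# - node i - 1#) * pow (- (1# - node i)) j) indices)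
      ≈⟨ binomialTransform-sumOver r (λ i j → (1# - node i - 1#) * pow (- (1# - node i)) j) indices ⟩
    sumOver (λ i → binomialTransform r (λ j → (1# - node i - 1#) * pow (- (1# - node i)) j)) indices
      ≈⟨ collect indices ⟩
    - p (suc r) ∎
    where
    collect : ∀ L → sumOver (λ i → binomialTransform r (λ j → (1# - node i - 1#) * pow (- (1# - node i)) j)) L
      ≈ - sumOver (λ i → pow (node i) (suc r)) L
    collect []      = solve 0 (con (+ 0) := :- con (+ 0)) refl
    collect (i ∷ L) = trans
      (+-cong (trans (binomialTransform-geometric r (1# - node i - 1#) (- (1# - node i)))
                (*-congˡ (pow-cong r (solve 1 (λ x → con (+ 1) :+ :- (con (+ 1) :- x) := x) refl (node i)))))
              (collect L))
      (solve 3 (λ x q s → (con (+ 1) :- x :- con (+ 1)) :* q :+ :- s := :- (x :* q :+ s)) refl (node i) _ _)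

  ι-bracket : ∀ a s b → ι (natℚ (N C a) ℚ.+ sgn s ℚ.* natℚ (N C b)) ≈ binom N a + pow (- 1#) s * binom N b
  ι-bracket a s b = trans (ι-+ (natℚ (N C a)) (sgn s ℚ.* natℚ (N C b)))
    (+-cong (ι-natℚ (N C a)) (trans (ι-* (sgn s) (natℚ (N C b))) (*-cong (ι-sgn s) (ι-natℚ (N C b)))))

  private
    -- The summand of innerTerm, with B standing for A ∸ 2 k.
    summand : ℕ → ℕ → ℕ → ℕ → ℚ
    summand m k B j =
      sgn (suc k) ℚ.* natℚ (suc N ℕ.^ j) ℚ.* β j λ'
        ℚ.* recip (suc N ℕ.* (m ℕ.+ k ℕ.+ 1) ℕ.* (j !))
        ℚ.* natℚ ((B ℕ.∸ 3) C (j ℕ.∸ 1))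
        ℚ.* (natℚ (N C (m ℕ.+ k)) ℚ.+ sgn (m ℕ.+ k) ℚ.* natℚ (N C (2 ℕ.* m ℕ.+ 2 ℕ.* k ℕ.+ 1)))

    ι-*₆ : ∀ q₁ q₂ q₃ q₄ q₅ q₆ → ι (q₁ ℚ.* q₂ ℚ.* q₃ ℚ.* q₄ ℚ.* q₅ ℚ.* q₆)
      ≈ ι q₁ * (ι q₂ * ι q₃) * ι q₄ * ι q₅ * ι q₆
    ι-*₆ q₁ q₂ q₃ q₄ q₅ q₆ =
      trans (ι-* (q₁ ℚ.* q₂ ℚ.* q₃ ℚ.* q₄ ℚ.* q₅) q₆) (*-congʳ
      (trans (ι-* (q₁ ℚ.* q₂ ℚ.* q₃ ℚ.* q₄) q₅) (*-congʳ
      (trans (ι-* (q₁ ℚ.* q₂ ℚ.* q₃) q₄) (*-congʳ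
      (trans (ι-* (q₁ ℚ.* q₂) q₃) (trans (*-congʳ (ι-* q₁ q₂)) (*-assoc _ _ _))))))))

    -- The bracket cancels the denominator `n (m + k + 1)` down to `e_{m+k}`, and the factorial
    -- cancels the one inside `β`. Three successors turn `B ∸ 3` into `r`.
    ι-summand : ∀ m k r i → ι (summand m k (suc (suc (suc r))) (suc i))
      ≈ - 1# * pow (- 1#) k * e (m ℕ.+ k) * (binom r i * scaled (suc i))
    ι-summand m k r i = begin
      ι (summand m k (suc (suc (suc r))) (suc i))
        ≈⟨ ι-*₆ (sgn (suc k)) (natℚ (suc N ℕ.^ suc i)) (β (suc i) λ')
             (recip (suc N ℕ.* (M ℕ.+ 1) ℕ.* (suc i !))) (natℚ (r C i))
             (natℚ (N C M) ℚ.+ sgn M ℚ.* natℚ (N C (2 ℕ.* m ℕ.+ 2 ℕ.* k ℕ.+ 1))) ⟩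
      ι (sgn (suc k)) * (ι (natℚ (suc N ℕ.^ suc i)) * ι (β (suc i) λ'))
        * ι (recip (suc N ℕ.* (M ℕ.+ 1) ℕ.* (suc i !))) * ι (natℚ (r C i))
        * ι (natℚ (N C M) ℚ.+ sgn M ℚ.* natℚ (N C (2 ℕ.* m ℕ.+ 2 ℕ.* k ℕ.+ 1)))
        ≈⟨ *-cong (*-cong (*-cong (*-cong (ι-sgn (suc k)) (ι-β (suc i)))
             (reflexive (≡.cong (λ M′ → ι (recip (suc N ℕ.* M′ ℕ.* (suc i !)))) (ℕₚ.+-comm M 1))))
             (ι-natℚ (r C i))) bracket ⟩
      s * (F * y) * ρ * binom r i * (n * natCast (suc M) * e M)
        ≈⟨ solve 8 (λ s F y ρ b n m e → s :* (F :* y) :* ρ :* b :* (n :* m :* e)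
             := s :* e :* (b :* y) :* (n :* m :* F :* ρ)) refl s F y ρ (binom r i) n (natCast (suc M)) (e M) ⟩
      s * e M * (binom r i * y) * (n * natCast (suc M) * F * ρ)
        ≈⟨ trans (*-congˡ denominator) (*-identityʳ _) ⟩
      s * e M * (binom r i * y) ∎
      where
      M = m ℕ.+ k
      s = pow (- 1#) (suc k)
      F = natCast (suc i !)
      y = scaled (suc i)
      ρ = ι (recip (suc N ℕ.* suc M ℕ.* (suc i !)))
      denominator : n * natCast (suc M) * F * ρ ≈ 1#
      denominator = trans
        (*-congʳ (sym (trans (natCast-* (suc N ℕ.* suc M) (suc i !)) (*-congʳ (natCast-* (suc N) (suc M))))))
        (ι-recip (suc N ℕ.* suc M ℕ.* (suc i !)) {{ℕₚ.m*n≢0 (suc N ℕ.* suc M) (suc i !) {{_}} {{ℕₚ._!≢0 (suc i)}}}})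
      index : ∀ m k → 2 ℕ.* m ℕ.+ 2 ℕ.* k ℕ.+ 1 ≡ suc (m ℕ.+ k ℕ.+ (m ℕ.+ k))
      index = solve-∀
      bracket : ι (natℚ (N C M) ℚ.+ sgn M ℚ.* natℚ (N C (2 ℕ.* m ℕ.+ 2 ℕ.* k ℕ.+ 1)))
        ≈ n * natCast (suc M) * e M
      bracket = trans (ι-bracket M M (2 ℕ.* m ℕ.+ 2 ℕ.* k ℕ.+ 1))
        (trans (reflexive (≡.cong (λ b → binom N M + pow (- 1#) M * binom N b) (index m k))) (sym (elem-closed M)))

  -- The hypothesis resolves the truncated subtractions: every `k` in the range of summation has
  -- `A - 2k ≥ 3`, and `r` is `A - 2k - 3`.
  ι-innerTerm : ∀ m A k r → A ≡ 2 ℕ.* k ℕ.+ suc (suc (suc r)) →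
    ι (innerTerm (suc N) m A k) ≈ pow (- 1#) k * (p (suc r) * e (m ℕ.+ k))
  ι-innerTerm m A k r A≡ = begin
    ι (sumℚ (map (summand m k (A ℕ.∸ 2 ℕ.* k)) (map suc (upTo (A ℕ.∸ 2 ℕ.* k ℕ.∸ 2)))))
      ≡⟨ ≡.cong (λ B → ι (sumℚ (map (summand m k B) (map suc (upTo (B ℕ.∸ 2))))))
           (≡.trans (≡.cong (ℕ._∸ 2 ℕ.* k) A≡) (ℕₚ.m+n∸m≡n (2 ℕ.* k) (suc (suc (suc r))))) ⟩
    ι (sumℚ (map (summand m k (suc (suc (suc r)))) (map suc (upTo (suc r)))))
      ≡⟨ ≡.cong (ι ∘ sumℚ) (map-∘ {g = summand m k (suc (suc (suc r)))} {f = suc} (upTo (suc r))) ⟨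
    ι (sumℚ (map (summand m k (suc (suc (suc r))) ∘ suc) (upTo (suc r))))
      ≈⟨ ι-sumℚ-upTo (summand m k (suc (suc (suc r))) ∘ suc) (suc r) ⟩
    sum< (suc r) (λ i → ι (summand m k (suc (suc (suc r))) (suc i)))
      ≈⟨ sum<-cong (suc r) (λ i _ → ι-summand m k r i) ⟩
    sum< (suc r) (λ i → - 1# * pow (- 1#) k * e (m ℕ.+ k) * (binom r i * scaled (suc i)))
      ≈⟨ trans (sum<-scale (- 1# * pow (- 1#) k * e (m ℕ.+ k)) (suc r) (λ i → binom r i * scaled (suc i))) (*-congˡ (bernoulli-powerSum r)) ⟩
    - 1# * pow (- 1#) k * e (m ℕ.+ k) * - p (suc r)
      ≈⟨ solve 3 (λ s e p → :- con (+ 1) :* s :* e :* :- p := s :* (p :* e)) refl (pow (- 1#) k) _ _ ⟩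
    pow (- 1#) k * (p (suc r) * e (m ℕ.+ k)) ∎

  even : ∀ m a → LHS (suc N) (suc m) ζ (2 ℕ.* suc a) ≈ ι (RHSeven (suc N) (suc m) (suc a))
  even m a = begin
    LHS (suc N) (suc m) ζ (2 ℕ.* suc a)
      ≈⟨ LHS-marked m (2 ℕ.* suc a) ⟩
    D (2 ℕ.* suc a) m
      ≡⟨ ≡.cong (λ A → D A m) (exponent a) ⟩
    D (a ℕ.* 2 ℕ.+ 2) m
      ≈⟨ unroll 2 a m ⟩
    sum< a (λ k → pow (- 1#) k * (p ((a ℕ.∸ suc k) ℕ.* 2 ℕ.+ 2) * e (suc m ℕ.+ k))) + pow (- 1#) a * D 2 (m ℕ.+ a)
      ≈⟨ +-cong (sum<-cong a (λ k k<a → sym (trans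
           (ι-innerTerm (suc m) (2 ℕ.* suc a) k ((a ℕ.∸ suc k) ℕ.* 2 ℕ.+ 1)
             (≡.trans (≡.cong (λ a → 2 ℕ.* suc a) (≡.sym (ℕₚ.m+[n∸m]≡n k<a))) (index k (a ℕ.∸ suc k))))
           (*-congˡ (*-congʳ (reflexive (≡.cong p (≡.sym (ℕₚ.+-suc ((a ℕ.∸ suc k) ℕ.* 2) 1)))))))))
           (sym boundary) ⟩
    sum< a (ι ∘ innerTerm (suc N) (suc m) (2 ℕ.* suc a)) + ι (sgn a ℚ.* natℚ M ℚ.* recip (suc N ℕ.* suc M) ℚ.* bracket)
      ≈⟨ +-congʳ (ι-sumℚ-upTo (innerTerm (suc N) (suc m) (2 ℕ.* suc a)) a) ⟨
    ι (sumℚ (map (innerTerm (suc N) (suc m) (2 ℕ.* suc a)) (upTo a)))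
      + ι (sgn a ℚ.* natℚ M ℚ.* recip (suc N ℕ.* suc M) ℚ.* bracket)
      ≈⟨ ι-+ (sumℚ (map (innerTerm (suc N) (suc m) (2 ℕ.* suc a)) (upTo a)))
           (sgn a ℚ.* natℚ M ℚ.* recip (suc N ℕ.* suc M) ℚ.* bracket) ⟨
    ι (RHSeven (suc N) (suc m) (suc a)) ∎
    where
    M = m ℕ.+ suc a
    bracket = natℚ (N C M) ℚ.+ sgn M ℚ.* natℚ (N C (2 ℕ.* suc m ℕ.+ 2 ℕ.* suc a ℕ.∸ 1))
    ρ = ι (recip (suc N ℕ.* suc M))
    exponent : ∀ a → 2 ℕ.* suc a ≡ a ℕ.* 2 ℕ.+ 2
    exponent = solve-∀
    index : ∀ k d → 2 ℕ.* suc (suc k ℕ.+ d) ≡ 2 ℕ.* k ℕ.+ suc (suc (suc (d ℕ.* 2 ℕ.+ 1)))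
    index = solve-∀
    last : ∀ m a → 2 ℕ.* suc m ℕ.+ 2 ℕ.* suc a ≡ suc (suc (m ℕ.+ suc a ℕ.+ (m ℕ.+ suc a)))
    last = solve-∀
    -- Here the depth is `m + 1` and `A = 2 (a + 1)`, so `M` is the `m + A/2 - 1` of the statement;
    -- as a numerator it comes from `marked-self`.
    boundary : ι (sgn a ℚ.* natℚ M ℚ.* recip (suc N ℕ.* suc M) ℚ.* bracket) ≈ pow (- 1#) a * D 2 (m ℕ.+ a)
    boundary = begin
      ι (sgn a ℚ.* natℚ M ℚ.* recip (suc N ℕ.* suc M) ℚ.* bracket)
        ≈⟨ trans (ι-* (sgn a ℚ.* natℚ M ℚ.* recip (suc N ℕ.* suc M)) bracket) (*-cong
             (trans (ι-* (sgn a ℚ.* natℚ M) (recip (suc N ℕ.* suc M))) (*-congʳ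
               (trans (ι-* (sgn a) (natℚ M)) (*-cong (ι-sgn a) (ι-natℚ M)))))
             (trans (ι-bracket M M (2 ℕ.* suc m ℕ.+ 2 ℕ.* suc a ℕ.∸ 1))
               (trans (reflexive (≡.cong (λ b → binom N M + pow (- 1#) M * binom N (b ℕ.∸ 1)) (last m a)))
                 (sym (elem-closed M))))) ⟩
      pow (- 1#) a * natCast M * ρ * (n * natCast (suc M) * e M)
        ≈⟨ solve 6 (λ s M ρ n m e → s :* M :* ρ :* (n :* m :* e) := s :* (M :* e) :* (n :* m :* ρ))
             refl (pow (- 1#) a) (natCast M) ρ n (natCast (suc M)) (e M) ⟩
      pow (- 1#) a * (natCast M * e M) * (n * natCast (suc M) * ρ)
        ≈⟨ trans (*-congˡ (trans (*-congʳ (sym (natCast-* (suc N) (suc M)))) (ι-recip (suc N ℕ.* suc M))))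
             (*-identityʳ _) ⟩
      pow (- 1#) a * (natCast M * e M)
        ≡⟨ ≡.cong (λ M → pow (- 1#) a * (natCast M * e M)) (ℕₚ.+-suc m a) ⟩
      pow (- 1#) a * (natCast (suc (m ℕ.+ a)) * e (suc (m ℕ.+ a)))
        ≈⟨ *-congˡ (trans (marked-cong (λ i → *-congˡ (*-identityʳ (node i))) (λ _ → refl) indices (m ℕ.+ a))
             (marked-self x² indices (m ℕ.+ a))) ⟨
      pow (- 1#) a * D 2 (m ℕ.+ a) ∎

  odd : ∀ m a → LHS (suc N) (suc m) ζ (2 ℕ.* a ℕ.+ 1) ≈ ι (RHSodd (suc N) (suc m) a)
  odd m a = begin
    LHS (suc N) (suc m) ζ (2 ℕ.* a ℕ.+ 1)
      ≈⟨ LHS-marked m (2 ℕ.* a ℕ.+ 1) ⟩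
    D (2 ℕ.* a ℕ.+ 1) m
      ≡⟨ ≡.cong (λ A → D (A ℕ.+ 1) m) (ℕₚ.*-comm 2 a) ⟩
    D (a ℕ.* 2 ℕ.+ 1) m
      ≈⟨ unroll 1 a m ⟩
    sum< a (λ k → pow (- 1#) k * (p ((a ℕ.∸ suc k) ℕ.* 2 ℕ.+ 1) * e (suc m ℕ.+ k))) + pow (- 1#) a * D 1 (m ℕ.+ a)
      ≈⟨ +-cong (sum<-cong a (λ k k<a → sym (trans
           (ι-innerTerm (suc m) (2 ℕ.* a ℕ.+ 1) k ((a ℕ.∸ suc k) ℕ.* 2)
             (≡.trans (≡.cong (λ a → 2 ℕ.* a ℕ.+ 1) (≡.sym (ℕₚ.m+[n∸m]≡n k<a))) (index k (a ℕ.∸ suc k))))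
           (*-congˡ (*-congʳ (reflexive (≡.cong p (ℕₚ.+-comm 1 ((a ℕ.∸ suc k) ℕ.* 2)))))))))
           (sym boundary) ⟩
    sum< a (ι ∘ innerTerm (suc N) (suc m) (2 ℕ.* a ℕ.+ 1)) + ι (sgn a ℚ.* λ' ℚ.* bracket)
      ≈⟨ +-congʳ (ι-sumℚ-upTo (innerTerm (suc N) (suc m) (2 ℕ.* a ℕ.+ 1)) a) ⟨
    ι (sumℚ (map (innerTerm (suc N) (suc m) (2 ℕ.* a ℕ.+ 1)) (upTo a))) + ι (sgn a ℚ.* λ' ℚ.* bracket)
      ≈⟨ ι-+ (sumℚ (map (innerTerm (suc N) (suc m) (2 ℕ.* a ℕ.+ 1)) (upTo a))) (sgn a ℚ.* λ' ℚ.* bracket) ⟨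
    ι (RHSodd (suc N) (suc m) a) ∎
    where
    M = m ℕ.+ a
    bracket = natℚ (N C suc M) ℚ.+ sgn M ℚ.* natℚ (N C (2 ℕ.* suc m ℕ.+ 2 ℕ.* a))
    index : ∀ k d → 2 ℕ.* (suc k ℕ.+ d) ℕ.+ 1 ≡ 2 ℕ.* k ℕ.+ suc (suc (suc (d ℕ.* 2)))
    index = solve-∀
    last : ∀ m a → 2 ℕ.* suc m ℕ.+ 2 ℕ.* a ≡ suc (suc (m ℕ.+ a ℕ.+ (m ℕ.+ a)))
    last = solve-∀
    -- With depth `m + 1` and `A = 2a + 1`, `M` is the sign exponent `m + (A-3)/2` of the statement,
    -- one less than the lower index of the first binomial, as in `marked-square`.
    boundary : ι (sgn a ℚ.* λ' ℚ.* bracket) ≈ pow (- 1#) a * D 1 M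
    boundary = begin
      ι (sgn a ℚ.* λ' ℚ.* bracket)
        ≈⟨ trans (ι-* (sgn a ℚ.* λ') bracket) (*-cong
             (trans (ι-* (sgn a) λ') (*-congʳ (ι-sgn a)))
             (trans (ι-bracket (suc M) M (2 ℕ.* suc m ℕ.+ 2 ℕ.* a))
               (trans (reflexive (≡.cong (λ b → binom N (suc M) + pow (- 1#) M * binom N b) (last m a)))
                 (sym (X.marked-square M))))) ⟩
      pow (- 1#) a * ι λ' * (n * marked node x² indices M)
        ≈⟨ solve 4 (λ s x n d → s :* x :* (n :* d) := s :* d :* (n :* x)) refl (pow (- 1#) a) (ι λ') n _ ⟩
      pow (- 1#) a * marked node x² indices M * (n * ι λ')
        ≈⟨ trans (*-congˡ (ι-recip (suc N))) (*-identityʳ _) ⟩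
      pow (- 1#) a * marked node x² indices M
        ≈⟨ *-congˡ (marked-cong (λ i → *-identityʳ (node i)) (λ _ → refl) indices M) ⟨
      pow (- 1#) a * D 1 M ∎

open import Data.Nat using (_*_; _+_; _≤_)

theorem4 : ∀ {c ℓ : Level} (K : Field c ℓ) → FieldOps.CharZero K →
    (n m : ℕ) → 1 ≤ n → 1 ≤ m →
    (ζ : Field.Carrier K) → FieldOps.IsPrimitiveRoot K ζ n →
    ((a : ℕ) → 1 ≤ a →
    Field._≈_ K (FieldOps.LHS K n m ζ (2 * a)) (FieldOps.ι K (RHSeven n m a)))
    × ((a : ℕ) →
    Field._≈_ K (FieldOps.LHS K n m ζ (2 * a + 1)) (FieldOps.ι K (RHSodd n m a)))
theorem4 K charZero (suc N) (suc m) _ _ ζ isPrimitive =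
  (λ { (suc a) _ → even m a }) , odd m
  where open Evaluation K charZero N ζ isPrimitive
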